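{- Let $A(n,m,\ell)$ be the number of overpartitions $\lambda$ of $n$ lying in the set $\mathscr{A}_{\{\overline{1}\}}^\veebar$ (defined below) such that $\sharp_{1,2}(\lambda)+2\sharp_{0,4}(\lambda)=m$ and $\sharp_{2,4}(\lambda)+\mathsf{O}(\lambda)=\ell$. Let $B(n,m,\ell)$ be the number of partitions of $n$ into distinct parts, none divisible by $4$, having exactly $m$ odd parts and exactly $\ell$ even parts. Then $A(n,m,\ell)=B(n,m,\ell)$ for all $n,m,\ell\ge 0$.
   Context: An overpartition of $n$ is a partition of $n$ in which the first occurrence of each distinct part value may be overlined. The set $\mathscr{A}_{\{\overline{1}\}}^\veebar$ consists of the overpartitions such that (1) only odd parts larger than $1$ may be overlined; (2) the difference between any two parts is at least $4$, and this inequality is strict (difference at least $5$) if the larger of the two parts is overlined or divisible by $4$, with the exception that $\overline{5}$ and $1$ may simultaneously appear as parts. For an overpartition $\lambda$, $\sharp_{a,M}(\lambda)$ is the number of parts of $\lambda$ (overlined or not) congruent to $a$ modulo $M$, and $\mathsf{O}(\lambda)$ is the number of overlined parts of $\lambda$. -}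

module Defs where

open import Data.Nat using (ℕ; zero; suc; _+_; _*_; _≡ᵇ_; _<ᵇ_; _%_)
open import Data.Bool using (Bool; true; false; _∧_; _∨_; not; if_then_else_; T)
open import Data.List using (List; []; _∷_; map)
open import Data.Nat.ListAction using (sum)
open import Data.Product using (_×_; _,_; Σ; proj₁; proj₂)
open import Relation.Binary.PropositionalEquality using (_≡_)

all : {A : Set} → (A → Bool) → List A → Bool
all p []       = true
all p (x ∷ xs) = p x ∧ all p xs

allPairs : {A : Set} → (A → A → Bool) → List A → Bool
allPairs p []       = true
allPairs p (x ∷ xs) = all (p x) xs ∧ allPairs p xs

allConsecutive : {A : Set} → (A → A → Bool) → List A → Bool
allConsecutive p []           = true
allConsecutive p (x ∷ [])     = true
allConsecutive p (x ∷ y ∷ xs) = p x y ∧ allConsecutive p (y ∷ xs)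

count : {A : Set} → (A → Bool) → List A → ℕ
count p []       = 0
count p (x ∷ xs) = (if p x then 1 else 0) + count p xs

_≤ᵇ_ : ℕ → ℕ → Bool
a ≤ᵇ b = a <ᵇ suc b

infix 4 _≤ᵇ_



-- Overpartitions
--
-- A part is a pair (value , overlined?).  An overpartition is encoded
-- canonically as a list of parts, with positive values, listed in
-- weakly decreasing order of value; among equal values only the first
-- occurrence may be overlined.

Part : Set
Part = ℕ × Bool

val : Part → ℕ
val = proj₁

over : Part → Bool
over = proj₂

isOverpartition : List Part → Bool
isOverpartition xs =
  all (λ x → 1 ≤ᵇ val x) xs ∧
  allConsecutive (λ x y → (val y <ᵇ val x) ∨ ((val y ≡ᵇ val x) ∧ not (over y))) xs

weight : List Part → ℕ
weight xs = sum (map val xs)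

♯ : ℕ → (M : ℕ) → .{{_ : Data.Nat.NonZero M}} → List Part → ℕ
♯ a M xs = count (λ x → val x % M ≡ᵇ a) xs

𝖮 : List Part → ℕ
𝖮 xs = count over xs

overlineOK : Part → Bool
overlineOK x = not (over x) ∨ ((val x % 2 ≡ᵇ 1) ∧ (2 ≤ᵇ val x))

gapOK : Part → Part → Bool
gapOK x y =
  ((val x ≡ᵇ 5) ∧ over x ∧ (val y ≡ᵇ 1) ∧ not (over y)) ∨
  ((val y + 4 ≤ᵇ val x) ∧
   (not (over x ∨ (val x % 4 ≡ᵇ 0)) ∨ (val y + 5 ≤ᵇ val x)))

inA : List Part → Bool
inA xs = all overlineOK xs ∧ allPairs gapOK xs

SetA : ℕ → ℕ → ℕ → Set
SetA n m ℓ = Σ (List Part) λ xs →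
  T (isOverpartition xs ∧ inA xs) ×
  weight xs ≡ n ×
  ♯ 1 2 xs + 2 * ♯ 0 4 xs ≡ m ×
  ♯ 2 4 xs + 𝖮 xs ≡ ℓ

isDistinctPartition : List ℕ → Bool
isDistinctPartition xs =
  all (λ a → 1 ≤ᵇ a) xs ∧ allConsecutive (λ a b → b <ᵇ a) xs

SetB : ℕ → ℕ → ℕ → Set
SetB n m ℓ = Σ (List ℕ) λ xs →
  T (isDistinctPartition xs ∧ all (λ a → not (a % 4 ≡ᵇ 0)) xs) ×
  sum xs ≡ n ×
  count (λ a → a % 2 ≡ᵇ 1) xs ≡ m ×
  count (λ a → a % 2 ≡ᵇ 0) xs ≡ ℓ

{-# OPTIONS --safe #-}
-- Subtract from every part of λ ∈ 𝒜 four times the number of smaller parts.  What is left is a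
-- weakly increasing sequence in which an overlined part or a multiple of 4 strictly exceeds its
-- predecessor (a pair 5̄, 1 is set aside first), so it is an arbitrary shuffle of three independent
-- sequences: odd parts (some overlined), parts ≡ 2 mod 4 and multiples of 4.  Partitions in ℬ
-- similarly split into odd parts and parts ≡ 2 mod 4.  The gaps of each such sequence are arbitrary.
--
-- Let i be the number of odd parts in ℬ, and ♯₁,₂ + 2 ♯₀,₄ in 𝒜.  Two moves generate ℬ, each element
-- in exactly one way, from the partitions with i = 0: raise the odd parts by 2 and put a new part 1
-- below them (weight + 2i + 1), or just raise the odd parts by 2 (weight + 2i, for i > 0).  On 𝒜 the
-- injections `insert` and `raise` change the weight by the same amounts, have disjoint images and
-- together reach every element with i > 0, so replaying the moves on 𝒜 is the bijection.
module Submission where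

open import Defs
open import Data.Bool using (Bool; true; false; _∧_; _∨_; not; T; if_then_else_)
open import Data.Bool.Properties using (T-∧; T-∨; T-≡; T-not-≡; T-irrelevant)
open import Data.List using (List; []; _∷_; _++_; _ʳ++_; length; map; reverse; partitionSums)
open import Data.List.Properties
  using (∷-injective; map-injective; map-++; map-∘; ++-identityʳ; reverse-injective; reverse-involutive)
open import Data.List.Relation.Binary.Permutation.Propositional
  using (_↭_; ↭-refl; ↭-reflexive; ↭-trans; ↭-sym; prep)
open import Data.List.Relation.Binary.Permutation.Propositional.Properties
  using (map⁺; ↭-reverse) renaming (shift to ↭-shift)
open import Data.List.Relation.Unary.All as All using (All; []; _∷_)
open import Data.Nat hiding (_≤ᵇ_)
open import Data.Nat.Induction using (<-wellFounded)
open import Data.Nat.ListAction using (sum)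
open import Data.Nat.ListAction.Properties using (sum-++; sum-↭)
open import Data.Nat.Properties
open import Data.Nat.Tactic.RingSolver using (solve-∀)
open import Data.Product using (_×_; _,_; Σ; ∃; proj₁; proj₂; map₁; map₂)
open import Data.Product.Properties using (,-injective)
open import Data.Sum using (_⊎_; inj₁; inj₂; [_,_])
open import Data.Sum.Properties using (inj₁-injective; inj₂-injective)
open import Data.Unit using (tt)
open import Function using (_∘_; const; Equivalence; mk↔ₛ′)
open import Function.Bundles using (_↔_)
open import Function.Properties.Inverse using (↔-sym; ↔-trans)
open import Induction.WellFounded using (Acc; acc)
open import Relation.Binary.PropositionalEquality hiding ([_])
open import Relation.Nullary using (contradiction; ofʸ; ofⁿ)

open Equivalence using (to; from)

private
  variable
    A B C X : Set
    v w : ℕ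

-- The bijection on gap codes

bit : Bool → ℕ
bit true  = 1
bit false = 0

-- The code (g₁ , m₁) ∷ (g₂ , m₂) ∷ … , smallest part first, stands for the odd parts 2tₙ + 1,
-- overlined when mₙ, with tₙ = tₙ₋₁ + mₙ + gₙ and t₀ = 0.
bars : List (ℕ × Bool) → ℕ
bars []            = 0
bars ((g , m) ∷ r) = bit m + bars r

weightD : List (ℕ × Bool) → ℕ
weightD []            = 0
weightD ((g , m) ∷ r) = suc (length r) * (2 * (bit m + g)) + 1 + weightD r

-- The sum of the numbers k tₙ + r, where t₁ = g₁ and tₙ = tₙ₋₁ + j + gₙ: a gap raises all later terms.
gapWeight : (k r j : ℕ) → List ℕ → ℕ
gapWeight k r j []       = 0
gapWeight k r j (g ∷ gs) = suc (length gs) * (k * g) + r + j * k * length gs + gapWeight k r j gs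

weightY weightZ weightO weightE : List ℕ → ℕ
weightY = gapWeight 4 2 0
weightZ = gapWeight 4 4 1
weightO = gapWeight 2 1 1
weightE = gapWeight 4 2 1

-- The number of parts of the exceptional pair 5̄, 1 and its weight; both vanish when the pair is
-- absent.
offset base : Bool → ℕ
offset f = if f then 2 else 0
base   f = if f then 6 else 0

-- What the subtraction took away: a part above `n` residual parts gets back `4 * (n + offset f)`,
-- the pair counting among the smaller parts. The weight of the pair is the bottom value.
staircase : Bool → ℕ → ℕ
staircase f zero    = base f
staircase f (suc n) = 4 * (n + offset f) + staircase f n

-- In (f , ds , ys , zs) the flag f says that 5̄ and 1 both occur; the three lists then code the other
-- parts, ds the odd ones, ys those ≡ 2 mod 4, zs the multiples of 4.
ACode : Set
ACode = Bool × List (ℕ × Bool) × List ℕ × List ℕ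

weightA mA ℓA : ACode → ℕ
weightA (f , ds , ys , zs) =
  weightD ds + (weightY ys + weightZ zs) + staircase f (length ds + (length ys + length zs))
mA (f , ds , ys , zs) = offset f + length ds + 2 * length zs
ℓA (f , ds , ys , zs) = bit f + bars ds + length ys

-- Gaps accumulate, so a larger first gap moves every term: by 4 in `ys` and `zs`, and by 2 in `ds`
-- for `upD`.
up : List ℕ → List ℕ
up []      = []
up (g ∷ r) = suc g ∷ r

upD : List (ℕ × Bool) → List (ℕ × Bool)
upD []            = []
upD ((g , m) ∷ r) = (suc g , m) ∷ r

-- Raising the exceptional pair 5̄, 1 gives 7, 3̄.
raise : ACode → ACode
raise (false , ds , ys , zs) = false , upD ds , ys , up zs
raise (true  , ds , ys , zs) = false , (0 , true) ∷ (0 , false) ∷ ds , ys , up zs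

-- A smallest part 1 and the new part fuse into a multiple of 4; otherwise a part ≡ 2 mod 4 of least
-- possible size and the new part fuse into an overlined part; otherwise the new part is a 1, forming
-- the exceptional pair with a smallest odd part 3̄ of the residual sequence.
insert : ACode → ACode
insert (true  , ds                , ys         , zs) = false , (0 , true) ∷ ds , ys , 0 ∷ zs
insert (false , (0 , false) ∷ ds  , ys         , zs) = false , upD ds , ys , 0 ∷ zs
insert (false , []                , 0 ∷ ys     , zs) = false , (0 , true) ∷ [] , ys , up zs
insert (false , (0 , true) ∷ ds   , 0 ∷ ys     , zs) = false , (0 , true) ∷ (0 , true) ∷ ds , ys , up zs
insert (false , (suc g , m) ∷ ds  , 0 ∷ ys     , zs) = false , (0 , true) ∷ (suc g , m) ∷ ds , ys , up zs
insert (false , []                , []         , zs) = false , (0 , false) ∷ [] , [] , zs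
insert (false , (0 , true) ∷ ds   , []         , zs) = true , ds , [] , zs
insert (false , (suc g , m) ∷ ds  , []         , zs) = false , (0 , false) ∷ (g , m) ∷ ds , [] , zs
insert (false , []                , suc h ∷ ys , zs) = false , (0 , false) ∷ [] , h ∷ ys , zs
insert (false , (0 , true) ∷ ds   , suc h ∷ ys , zs) = true , ds , h ∷ ys , zs
insert (false , (suc g , m) ∷ ds  , suc h ∷ ys , zs) = false , (0 , false) ∷ (g , m) ∷ ds , h ∷ ys , zs

-- Undoing the last move

data Step : Set where
  initial  : List ℕ → Step
  raised   : ACode → Step
  inserted : ACode → Step

unpeel : Step → ACode
unpeel (initial ys) = false , [] , ys , []
unpeel (raised c)   = raise c
unpeel (inserted c) = insert c

-- The flag or a leading gap 0 in `ds` or `zs` betrays an insertion, since raising an unflagged code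
-- leaves no leading gap 0. The one overlap is the raised exceptional pair: it too starts with 3̄,
-- and is told apart by the gap `(0 , false)` right after it and by `zs` not starting with 0.
peel : ACode → Step
peel (true  , ds , ys , zs) = inserted (false , (0 , true) ∷ ds , up ys , zs)
peel (false , (0 , false) ∷ ds , ys , zs) = inserted (false , upD ds , up ys , zs)
peel (false , (0 , true) ∷ ds , ys , 0 ∷ zs) = inserted (true , ds , ys , zs)
peel (false , (0 , true) ∷ [] , ys , []) = inserted (false , [] , 0 ∷ ys , [])
peel (false , (0 , true) ∷ [] , ys , suc k ∷ zs) = inserted (false , [] , 0 ∷ ys , k ∷ zs)
peel (false , (0 , true) ∷ (0 , false) ∷ ds , ys , []) = raised (true , ds , ys , [])
peel (false , (0 , true) ∷ (0 , false) ∷ ds , ys , suc k ∷ zs) = raised (true , ds , ys , k ∷ zs)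
peel (false , (0 , true) ∷ (0 , true) ∷ ds , ys , []) = inserted (false , (0 , true) ∷ ds , 0 ∷ ys , [])
peel (false , (0 , true) ∷ (0 , true) ∷ ds , ys , suc k ∷ zs) = inserted (false , (0 , true) ∷ ds , 0 ∷ ys , k ∷ zs)
peel (false , (0 , true) ∷ (suc g , m) ∷ ds , ys , []) = inserted (false , (suc g , m) ∷ ds , 0 ∷ ys , [])
peel (false , (0 , true) ∷ (suc g , m) ∷ ds , ys , suc k ∷ zs) = inserted (false , (suc g , m) ∷ ds , 0 ∷ ys , k ∷ zs)
peel (false , [] , ys , 0 ∷ zs) = inserted (false , (0 , false) ∷ [] , ys , zs)
peel (false , (suc g , m) ∷ ds , ys , 0 ∷ zs) = inserted (false , (0 , false) ∷ (g , m) ∷ ds , ys , zs)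
peel (false , [] , ys , []) = initial ys
peel (false , [] , ys , suc k ∷ zs) = raised (false , [] , ys , k ∷ zs)
peel (false , (suc g , m) ∷ ds , ys , []) = raised (false , (g , m) ∷ ds , ys , [])
peel (false , (suc g , m) ∷ ds , ys , suc k ∷ zs) = raised (false , (g , m) ∷ ds , ys , k ∷ zs)

peel-insert : ∀ c → peel (insert c) ≡ inserted c
peel-insert (true , ds , ys , zs) = refl
peel-insert (false , (0 , false) ∷ [] , ys , zs) = refl
peel-insert (false , (0 , false) ∷ (g , m) ∷ ds , ys , zs) = refl
peel-insert (false , [] , 0 ∷ ys , []) = refl
peel-insert (false , [] , 0 ∷ ys , z ∷ zs) = refl
peel-insert (false , (0 , true) ∷ ds , 0 ∷ ys , []) = refl
peel-insert (false , (0 , true) ∷ ds , 0 ∷ ys , z ∷ zs) = refl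
peel-insert (false , (suc g , m) ∷ ds , 0 ∷ ys , []) = refl
peel-insert (false , (suc g , m) ∷ ds , 0 ∷ ys , z ∷ zs) = refl
peel-insert (false , [] , [] , zs) = refl
peel-insert (false , (0 , true) ∷ ds , [] , zs) = refl
peel-insert (false , (suc g , m) ∷ ds , [] , zs) = refl
peel-insert (false , [] , suc h ∷ ys , zs) = refl
peel-insert (false , (0 , true) ∷ ds , suc h ∷ ys , zs) = refl
peel-insert (false , (suc g , m) ∷ ds , suc h ∷ ys , zs) = refl

-- Without flag and with `ds` and `zs` empty, `raise` changes nothing and `peel` answers `initial`;
-- positivity of `mA` excludes exactly this case.
peel-raise : ∀ c → 0 < mA c → peel (raise c) ≡ raised c
peel-raise (false , [] , ys , []) ()
peel-raise (false , [] , ys , z ∷ zs) _ = refl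
peel-raise (false , (g , m) ∷ ds , ys , []) _ = refl
peel-raise (false , (g , m) ∷ ds , ys , z ∷ zs) _ = refl
peel-raise (true , ds , ys , []) _ = refl
peel-raise (true , ds , ys , z ∷ zs) _ = refl

unpeel-peel : ∀ c → unpeel (peel c) ≡ c
unpeel-peel (true , ds , [] , zs) = refl
unpeel-peel (true , ds , y ∷ ys , zs) = refl
unpeel-peel (false , (0 , false) ∷ [] , [] , zs) = refl
unpeel-peel (false , (0 , false) ∷ [] , y ∷ ys , zs) = refl
unpeel-peel (false , (0 , false) ∷ (g , m) ∷ ds , [] , zs) = refl
unpeel-peel (false , (0 , false) ∷ (g , m) ∷ ds , y ∷ ys , zs) = refl
unpeel-peel (false , (0 , true) ∷ ds , ys , 0 ∷ zs) = refl
unpeel-peel (false , (0 , true) ∷ [] , ys , []) = refl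
unpeel-peel (false , (0 , true) ∷ [] , ys , suc k ∷ zs) = refl
unpeel-peel (false , (0 , true) ∷ (0 , false) ∷ ds , ys , []) = refl
unpeel-peel (false , (0 , true) ∷ (0 , false) ∷ ds , ys , suc k ∷ zs) = refl
unpeel-peel (false , (0 , true) ∷ (0 , true) ∷ ds , ys , []) = refl
unpeel-peel (false , (0 , true) ∷ (0 , true) ∷ ds , ys , suc k ∷ zs) = refl
unpeel-peel (false , (0 , true) ∷ (suc g , m) ∷ ds , ys , []) = refl
unpeel-peel (false , (0 , true) ∷ (suc g , m) ∷ ds , ys , suc k ∷ zs) = refl
unpeel-peel (false , [] , ys , 0 ∷ zs) = refl
unpeel-peel (false , (suc g , m) ∷ ds , ys , 0 ∷ zs) = refl
unpeel-peel (false , [] , ys , []) = refl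
unpeel-peel (false , [] , ys , suc k ∷ zs) = refl
unpeel-peel (false , (suc g , m) ∷ ds , ys , []) = refl
unpeel-peel (false , (suc g , m) ∷ ds , ys , suc k ∷ zs) = refl

-- Makes undoing a raising strictly lower the weight, as the induction in `build-surjective`
-- requires.
peel-raised-m : ∀ c {c′} → peel c ≡ raised c′ → 0 < mA c′
peel-raised-m (true , ds , ys , zs) ()
peel-raised-m (false , (0 , false) ∷ ds , ys , zs) ()
peel-raised-m (false , (0 , true) ∷ ds , ys , 0 ∷ zs) ()
peel-raised-m (false , (0 , true) ∷ [] , ys , []) ()
peel-raised-m (false , (0 , true) ∷ [] , ys , suc k ∷ zs) ()
peel-raised-m (false , (0 , true) ∷ (0 , false) ∷ ds , ys , []) refl = z<s
peel-raised-m (false , (0 , true) ∷ (0 , false) ∷ ds , ys , suc k ∷ zs) refl = z<s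
peel-raised-m (false , (0 , true) ∷ (0 , true) ∷ ds , ys , []) ()
peel-raised-m (false , (0 , true) ∷ (0 , true) ∷ ds , ys , suc k ∷ zs) ()
peel-raised-m (false , (0 , true) ∷ (suc g , m) ∷ ds , ys , []) ()
peel-raised-m (false , (0 , true) ∷ (suc g , m) ∷ ds , ys , suc k ∷ zs) ()
peel-raised-m (false , [] , ys , 0 ∷ zs) ()
peel-raised-m (false , (suc g , m) ∷ ds , ys , 0 ∷ zs) ()
peel-raised-m (false , [] , ys , []) ()
peel-raised-m (false , [] , ys , suc k ∷ zs) refl = z<s
peel-raised-m (false , (suc g , m) ∷ ds , ys , []) refl = z<s
peel-raised-m (false , (suc g , m) ∷ ds , ys , suc k ∷ zs) refl = z<s

-- Effect of the moves on weight and statistics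

length-up : ∀ r → length (up r) ≡ length r
length-up []      = refl
length-up (_ ∷ _) = refl

length-upD : ∀ r → length (upD r) ≡ length r
length-upD []      = refl
length-upD (_ ∷ _) = refl

bars-upD : ∀ r → bars (upD r) ≡ bars r
bars-upD []      = refl
bars-upD (_ ∷ _) = refl

weight-upD : ∀ r → weightD (upD r) ≡ 2 * length r + weightD r
weight-upD []            = refl
weight-upD ((g , m) ∷ r) = arith (length r) (bit m) g (weightD r)
  where
  arith : ∀ l b g w → suc l * (2 * (b + suc g)) + 1 + w ≡ 2 * suc l + (suc l * (2 * (b + g)) + 1 + w)
  arith = solve-∀

weight-up : ∀ k r j gs → gapWeight k r j (up gs) ≡ k * length gs + gapWeight k r j gs
weight-up k r j []       = sym (trans (+-identityʳ (k * 0)) (*-zeroʳ k))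
weight-up k r j (g ∷ gs) = arith k r (j * k * length gs) (length gs) g (gapWeight k r j gs)
  where
  arith : ∀ k r j l g w → suc l * (k * suc g) + r + j + w ≡ k * suc l + (suc l * (k * g) + r + j + w)
  arith = solve-∀

-- The pair weighs 6 where the two lowest steps of an ordinary staircase weigh 0 + 4; all higher
-- steps agree.
staircase-true : ∀ n → staircase true n ≡ 2 + staircase false (2 + n)
staircase-true zero    = refl
staircase-true (suc n) rewrite staircase-true n = arith n (staircase false n)
  where
  arith : ∀ n s → 4 * (n + 2) + (2 + (4 * (suc n + 0) + (4 * (n + 0) + s)))
                ≡ 2 + (4 * (suc (suc n) + 0) + (4 * (suc n + 0) + (4 * (n + 0) + s)))
  arith = solve-∀

-- An odd part counts once in `mA` and gains 2, a multiple of 4 counts twice and gains 4. Under the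
-- flag the pair 5̄, 1 becomes 7, 3̄, and the 3̄ now heading the code moves the remaining odd parts
-- up by 2.
weight-raise : ∀ c → weightA (raise c) ≡ 2 * mA c + weightA c
weight-raise (false , ds , ys , zs)
  rewrite weight-upD ds | weight-up 4 4 1 zs | length-upD ds | length-up zs
  = arith (length ds) (length zs) (weightD ds) (weightY ys) (weightZ zs) _
  where
  arith : ∀ a c D Y Z S → 2 * a + D + (Y + (4 * c + Z)) + S ≡ 2 * (0 + a + 2 * c) + (D + (Y + Z) + S)
  arith = solve-∀
weight-raise (true , ds , ys , zs)
  rewrite weight-up 4 4 1 zs | length-up zs | staircase-true (length ds + (length ys + length zs))
  = arith (length ds) (length zs) (weightD ds) (weightY ys) (weightZ zs) _
  where
  arith : ∀ a c D Y Z S →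
    suc (suc a) * (2 * 1) + 1 + (suc a * (2 * 0) + 1 + D) + (Y + (4 * c + Z)) + S
    ≡ 2 * (2 + a + 2 * c) + (D + (Y + Z) + (2 + S))
  arith = solve-∀

-- A record, so that the cases below are compared by their codes and not by their unfolded weights.
record _Extends_ (c′ c : ACode) : Set where
  field
    weight-eq : weightA c′ ≡ 1 + 2 * mA c + weightA c

open _Extends_

module _ (ds : List (ℕ × Bool)) (ys zs : List ℕ) where

  private
    a = length ds
    b = length ys
    c = length zs

  -- Turning the 1 into a 4 adds 3. Strictness pushes the multiples of 4 behind the new one up by 4,
  -- and `upD` gives every other odd part 2.
  weight-insert-convert :
    (false , upD ds , ys , 0 ∷ zs) Extends (false , (0 , false) ∷ ds , ys , zs)
  weight-insert-convert .weight-eq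
    rewrite weight-upD ds | length-upD ds | +-suc b c | +-suc a (b + c)
    = arith a c (weightD ds) (weightY ys) (weightZ zs) _
    where
    arith : ∀ a c D Y Z S → 2 * a + D + (Y + (suc c * (4 * 0) + 4 + 1 * 4 * c + Z)) + S
      ≡ 1 + 2 * (suc a + 2 * c) + ((suc a * (2 * 0) + 1 + D) + (Y + Z) + S)
    arith = solve-∀

  -- A residual 3̄ and 4 with the two lowest steps weigh 11 against 6 for the pair, a gain of 5. The
  -- odd parts behind the 3̄ gain 2, the multiples of 4 behind the 4 gain 4.
  weight-insert-true :
    (false , (0 , true) ∷ ds , ys , 0 ∷ zs) Extends (true , ds , ys , zs)
  weight-insert-true .weight-eq
    rewrite +-suc b c | +-suc a (b + c) | staircase-true (a + (b + c))
    = arith a c (weightD ds) (weightY ys) (weightZ zs) _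
    where
    arith : ∀ a c D Y Z S → (suc a * (2 * 1) + 1 + D) + (Y + (suc c * (4 * 0) + 4 + 1 * 4 * c + Z)) + S
      ≡ 1 + 2 * (2 + a + 2 * c) + (D + (Y + Z) + (2 + S))
    arith = solve-∀

  -- The number of parts is unchanged: a residual 2 becomes 3̄, a gain of 1, and the odd parts
  -- behind it move up by 2.
  weight-insert-mark :
    (false , (0 , true) ∷ ds , ys , up zs) Extends (false , ds , 0 ∷ ys , zs)
  weight-insert-mark .weight-eq
    rewrite weight-up 4 4 1 zs | length-up zs | +-suc a (b + c)
    = arith a b c (weightD ds) (weightY ys) (weightZ zs) _
    where
    arith : ∀ a b c D Y Z S → (suc a * (2 * 1) + 1 + D) + (Y + (4 * c + Z)) + S
      ≡ 1 + 2 * (a + 2 * c) + (D + ((suc b * (4 * 0) + 2 + 0 * 4 * b + Y) + Z) + S)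
    arith = solve-∀

  -- A new 1 below everything lifts every other part by one step of 4. Undoing `upD` and `up` takes
  -- 2 back from odd parts and 4 from parts congruent to 2 modulo 4. Writing the source as an image
  -- of `upD` and `up` covers empty lists too.
  weight-insert-zero : ∀ {ds′ ys′} → upD ds ≡ ds′ → up ys ≡ ys′ →
    (false , (0 , false) ∷ ds , ys , zs) Extends (false , ds′ , ys′ , zs)
  weight-insert-zero refl refl .weight-eq
    rewrite weight-upD ds | length-upD ds | weight-up 4 2 0 ys | length-up ys
    = arith a b c (weightD ds) (weightY ys) (weightZ zs) _
    where
    arith : ∀ a b c D Y Z S → (suc a * (2 * 0) + 1 + D) + (Y + Z) + (4 * (a + (b + c) + 0) + S)
      ≡ 1 + 2 * (a + 2 * c) + (2 * a + D + (4 * b + Y + Z) + S)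
    arith = solve-∀

  -- The smallest part 3̄ becomes 5̄ over a new 1, a gain of 3. The other parts climb one step of 4,
  -- against which the odd ones lose the 2 owed to the 3̄ before them and those congruent to 2
  -- modulo 4 lose the 4 of `up`.
  weight-insert-exception : ∀ {ys′} → up ys ≡ ys′ →
    (true , ds , ys , zs) Extends (false , (0 , true) ∷ ds , ys′ , zs)
  weight-insert-exception refl .weight-eq
    rewrite weight-up 4 2 0 ys | length-up ys | staircase-true (a + (b + c))
    = arith a b c (weightD ds) (weightY ys) (weightZ zs) _
    where
    arith : ∀ a b c D Y Z S → D + (Y + Z) + (2 + (4 * (suc (a + (b + c)) + 0) + S))
      ≡ 1 + 2 * (suc a + 2 * c) + ((suc a * (2 * 1) + 1 + D) + (4 * b + Y + Z) + S)
    arith = solve-∀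

insert-extends : ∀ c → insert c Extends c
insert-extends (true , ds , ys , zs) = weight-insert-true ds ys zs
insert-extends (false , (0 , false) ∷ ds , ys , zs) = weight-insert-convert ds ys zs
insert-extends (false , [] , 0 ∷ ys , zs) = weight-insert-mark [] ys zs
insert-extends (false , (0 , true) ∷ ds , 0 ∷ ys , zs) = weight-insert-mark ((0 , true) ∷ ds) ys zs
insert-extends (false , (suc g , m) ∷ ds , 0 ∷ ys , zs) = weight-insert-mark ((suc g , m) ∷ ds) ys zs
insert-extends (false , [] , [] , zs) = weight-insert-zero [] [] zs refl refl
insert-extends (false , (0 , true) ∷ ds , [] , zs) = weight-insert-exception ds [] zs refl
insert-extends (false , (suc g , m) ∷ ds , [] , zs) = weight-insert-zero ((g , m) ∷ ds) [] zs refl refl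
insert-extends (false , [] , suc h ∷ ys , zs) = weight-insert-zero [] (h ∷ ys) zs refl refl
insert-extends (false , (0 , true) ∷ ds , suc h ∷ ys , zs) = weight-insert-exception ds (h ∷ ys) zs refl
insert-extends (false , (suc g , m) ∷ ds , suc h ∷ ys , zs) = weight-insert-zero ((g , m) ∷ ds) (h ∷ ys) zs refl refl

weight-insert : ∀ c → weightA (insert c) ≡ 1 + 2 * mA c + weightA c
weight-insert c = insert-extends c .weight-eq

m-raise : ∀ c → mA (raise c) ≡ mA c
m-raise (false , ds , ys , zs) rewrite length-upD ds | length-up zs = refl
m-raise (true  , ds , ys , zs) rewrite length-up zs = refl

m-insert : ∀ c → mA (insert c) ≡ suc (mA c)
m-insert (true , ds , ys , zs) rewrite *-suc 2 (length zs) = arith (length ds) (length zs)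
  where
  arith : ∀ a c → suc a + (2 + 2 * c) ≡ suc (2 + a + 2 * c)
  arith = solve-∀
m-insert (false , (0 , false) ∷ ds , ys , zs) rewrite length-upD ds = arith (length ds) (length zs)
  where
  arith : ∀ a c → a + 2 * suc c ≡ suc (suc a + 2 * c)
  arith = solve-∀
m-insert (false , [] , 0 ∷ ys , zs) rewrite length-up zs = refl
m-insert (false , (0 , true) ∷ ds , 0 ∷ ys , zs) rewrite length-up zs = refl
m-insert (false , (suc g , m) ∷ ds , 0 ∷ ys , zs) rewrite length-up zs = refl
m-insert (false , [] , [] , zs) = refl
m-insert (false , (0 , true) ∷ ds , [] , zs) = refl
m-insert (false , (suc g , m) ∷ ds , [] , zs) = refl
m-insert (false , [] , suc h ∷ ys , zs) = refl
m-insert (false , (0 , true) ∷ ds , suc h ∷ ys , zs) = refl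
m-insert (false , (suc g , m) ∷ ds , suc h ∷ ys , zs) = refl

ℓ-raise : ∀ c → ℓA (raise c) ≡ ℓA c
ℓ-raise (false , ds , ys , zs) rewrite bars-upD ds = refl
ℓ-raise (true  , ds , ys , zs) = refl

ℓ-insert : ∀ c → ℓA (insert c) ≡ ℓA c
ℓ-insert (true , ds , ys , zs) = refl
ℓ-insert (false , (0 , false) ∷ ds , ys , zs) rewrite bars-upD ds = refl
ℓ-insert (false , [] , 0 ∷ ys , zs) = refl
ℓ-insert (false , (0 , true) ∷ ds , 0 ∷ ys , zs) = cong suc (sym (+-suc (bars ds) (length ys)))
ℓ-insert (false , (suc g , m) ∷ ds , 0 ∷ ys , zs) = sym (+-suc (bit m + bars ds) (length ys))
ℓ-insert (false , [] , [] , zs) = refl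
ℓ-insert (false , (0 , true) ∷ ds , [] , zs) = refl
ℓ-insert (false , (suc g , m) ∷ ds , [] , zs) = refl
ℓ-insert (false , [] , suc h ∷ ys , zs) = refl
ℓ-insert (false , (0 , true) ∷ ds , suc h ∷ ys , zs) = refl
ℓ-insert (false , (suc g , m) ∷ ds , suc h ∷ ys , zs) = refl

-- Replaying the moves

raise^ : ℕ → ACode → ACode
raise^ zero    c = c
raise^ (suc n) c = raise (raise^ n c)

-- `ks` is the gap code of the even parts in ℬ and `ss` that of the odd parts. An entry of `ss` is
-- one insertion followed by that many raisings, so the smallest odd part is played last.
build : List ℕ → List ℕ → ACode
build []       ks = false , [] , ks , []
build (s ∷ ss) ks = raise^ s (insert (build ss ks))

m-raise^ : ∀ n c → mA (raise^ n c) ≡ mA c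
m-raise^ zero    c = refl
m-raise^ (suc n) c = trans (m-raise (raise^ n c)) (m-raise^ n c)

ℓ-raise^ : ∀ n c → ℓA (raise^ n c) ≡ ℓA c
ℓ-raise^ zero    c = refl
ℓ-raise^ (suc n) c = trans (ℓ-raise (raise^ n c)) (ℓ-raise^ n c)

weight-raise^ : ∀ n c → weightA (raise^ n c) ≡ n * (2 * mA c) + weightA c
weight-raise^ zero    c = refl
weight-raise^ (suc n) c
  rewrite weight-raise (raise^ n c) | m-raise^ n c | weight-raise^ n c
  = sym (+-assoc (2 * mA c) (n * (2 * mA c)) (weightA c))

m-build : ∀ ss ks → mA (build ss ks) ≡ length ss
m-build []       ks = refl
m-build (s ∷ ss) ks =
  trans (m-raise^ s _) (trans (m-insert (build ss ks)) (cong suc (m-build ss ks)))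

ℓ-build : ∀ ss ks → ℓA (build ss ks) ≡ length ks
ℓ-build []       ks = refl
ℓ-build (s ∷ ss) ks =
  trans (ℓ-raise^ s _) (trans (ℓ-insert (build ss ks)) (ℓ-build ss ks))

-- Residual parts congruent to 2 modulo 4 may repeat; the staircase spaces them by 4, which is the
-- jump 1 in `weightE`.
weightY-staircase : ∀ r → weightY r + staircase false (length r) ≡ weightE r
weightY-staircase []      = refl
weightY-staircase (k ∷ r) rewrite sym (weightY-staircase r) =
  arith (length r) k (weightY r) (staircase false (length r))
  where
  arith : ∀ l k w s → suc l * (4 * k) + 2 + 0 * 4 * l + w + (4 * (l + 0) + s)
                    ≡ suc l * (4 * k) + 2 + 1 * 4 * l + (w + s)
  arith = solve-∀

-- After `l` insertions, one more followed by `s` raisings adds `1 + 2 * l` and `s * (2 * suc l)`,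
-- just as a new first gap `s` does in `weightO`.
weight-build : ∀ ss ks → weightA (build ss ks) ≡ weightO ss + weightE ks
weight-build [] ks
  rewrite +-identityʳ (weightY ks) | +-identityʳ (length ks) = weightY-staircase ks
weight-build (s ∷ ss) ks
  rewrite weight-raise^ s (insert (build ss ks)) | m-insert (build ss ks)
        | weight-insert (build ss ks) | m-build ss ks | weight-build ss ks
  = arith s (length ss) (weightO ss) (weightE ks)
  where
  arith : ∀ s l o e → s * (2 * suc l) + (1 + 2 * l + (o + e)) ≡ suc l * (2 * s) + 1 + 1 * 2 * l + o + e
  arith = solve-∀

m-insert-positive : ∀ s c → 0 < mA (raise^ s (insert c))
m-insert-positive s c rewrite m-raise^ s (insert c) | m-insert c = z<s

raised-injective : ∀ {c c′} → raised c ≡ raised c′ → c ≡ c′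
raised-injective refl = refl

inserted-injective : ∀ {c c′} → inserted c ≡ inserted c′ → c ≡ c′
inserted-injective refl = refl

peel-raise^-insert : ∀ s c → peel (raise^ (suc s) (insert c)) ≡ raised (raise^ s (insert c))
peel-raise^-insert s c = peel-raise _ (m-insert-positive s c)

-- `peel` distinguishes raised from inserted codes, so raisings can be counted off until the
-- insertion appears.
raise^-insert-injective : ∀ s s′ {c c′} →
  raise^ s (insert c) ≡ raise^ s′ (insert c′) → s ≡ s′ × c ≡ c′
raise^-insert-injective zero zero {c} {c′} eq =
  refl , inserted-injective (trans (sym (peel-insert c)) (trans (cong peel eq) (peel-insert c′)))
raise^-insert-injective zero (suc s′) {c} {c′} eq
  with () ← trans (sym (peel-insert c)) (trans (cong peel eq) (peel-raise^-insert s′ c′))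
raise^-insert-injective (suc s) zero {c} {c′} eq
  with () ← trans (sym (peel-raise^-insert s c)) (trans (cong peel eq) (peel-insert c′))
raise^-insert-injective (suc s) (suc s′) {c} {c′} eq
  with refl , e ← raise^-insert-injective s s′ (raised-injective
         (trans (sym (peel-raise^-insert s c)) (trans (cong peel eq) (peel-raise^-insert s′ c′))))
  = refl , e

build-injective : ∀ ss ss′ {ks ks′} → build ss ks ≡ build ss′ ks′ → ss ≡ ss′ × ks ≡ ks′
build-injective [] [] refl = refl , refl
build-injective [] (s ∷ ss) {ks′ = ks′} eq
  with () ← subst (0 <_) (cong mA (sym eq)) (m-insert-positive s (build ss ks′))
build-injective (s ∷ ss) [] {ks} eq
  with () ← subst (0 <_) (cong mA eq) (m-insert-positive s (build ss ks))
build-injective (s ∷ ss) (s′ ∷ ss′) eq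
  with refl , e ← raise^-insert-injective s s′ eq
  with refl , refl ← build-injective ss ss′ e
  = refl , refl

build-surjective : ∀ c → ∃ λ ss → ∃ λ ks → build ss ks ≡ c
build-surjective c = go c (<-wellFounded (weightA c))
  where
  go : ∀ c → Acc _<_ (weightA c) → ∃ λ ss → ∃ λ ks → build ss ks ≡ c
  go c (acc rs) with peel c in eq | unpeel-peel c
  ... | initial ys | refl = [] , ys , refl
  ... | inserted c′ | refl
    with ss , ks , refl ← go c′ (rs (subst (weightA c′ <_) (sym (weight-insert c′))
                                       (s≤s (m≤n+m (weightA c′) (2 * mA c′)))))
    = 0 ∷ ss , ks , refl
  ... | raised c′ | refl
    -- As `mA c′` is positive, the raising added weight and the induction hypothesis applies to
    -- `c′`.
    with mA c′ in m≡ | peel-raised-m c eq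
  ... | suc k | _
    with go c′ (rs (subst (weightA c′ <_)
                     (trans (cong (λ m → 2 * m + weightA c′) (sym m≡)) (sym (weight-raise c′)))
                     (s≤s (m≤n+m (weightA c′) (k + 1 * suc k)))))
  ... | s ∷ ss , ks , refl = suc s ∷ ss , ks , refl
  -- A code built without insertions has `mA` equal to 0.
  ... | [] , ks , refl with () ← m≡

-- Shuffles of increasing sequences and their gap codes

-- An element x may come after the bound v when v + slack x ≤ size x.  In 𝒜 the bound is the size of
-- the previous element and slack x = 1 makes the inequality strict; in ℬ all slacks are 0 and the
-- bound is post = 1 more than the previous element.
record Scale (A : Set) : Set where
  field
    size slack : A → ℕ

open Scale

_⊕_ : Scale A → Scale B → Scale (A ⊎ B)
(S ⊕ T) .size  = [ size S , size T ]
(S ⊕ T) .slack = [ slack S , slack T ]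

data Ascending (S : Scale A) (post v : ℕ) : List A → Set where
  []  : Ascending S post v []
  _∷_ : ∀ {x xs} → v + slack S x ≤ size S x → Ascending S post (size S x + post) xs →
        Ascending S post v (x ∷ xs)

-- The value 1 on the empty list is the bound for the smallest element; with slack 1 it keeps a part
-- 1 from being overlined.
top : Scale A → ℕ → List A → ℕ
top S post []      = 1
top S post (x ∷ _) = size S x + post

data Descending (S : Scale A) (post : ℕ) : List A → Set where
  []  : Descending S post []
  _∷_ : ∀ {x xs} → top S post xs + slack S x ≤ size S x → Descending S post xs →
        Descending S post (x ∷ xs)

module _ {S : Scale A} {post : ℕ} where

  weaken : ∀ {xs} → v ≤ w → Ascending S post w xs → Ascending S post v xs
  weaken v≤w []       = []
  weaken v≤w (p ∷ ps) = ≤-trans (+-monoˡ-≤ _ v≤w) p ∷ ps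

  -- The accumulator holds the elements already passed, so its head supplies the bound for the rest.
  ʳ++-descending : ∀ {xs acc} → Ascending S post (top S post acc) xs → Descending S post acc →
                   Descending S post (xs ʳ++ acc)
  ʳ++-descending []       q = q
  ʳ++-descending (p ∷ ps) q = ʳ++-descending ps (p ∷ q)

  ʳ++-ascending : ∀ {xs acc} → Descending S post xs → Ascending S post (top S post xs) acc →
                  Ascending S post 1 (xs ʳ++ acc)
  ʳ++-ascending []       q = q
  ʳ++-ascending (p ∷ ps) q = ʳ++-ascending ps (p ∷ q)

-- Sizes of different kinds never coincide, and `post` and slack together ask for no more than
-- strict inequality. Elements of different kinds thus put no condition on each other, and two
-- ascending lists have exactly one ascending shuffle.
module Merge (S : Scale A) (T : Scale B) (post : ℕ)
             (apart : ∀ x y → size S x ≢ size T y)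
             (tightˡ : ∀ x → post + slack S x ≤ 1) (tightʳ : ∀ y → post + slack T y ≤ 1) where

  merge : List A → List B → List (A ⊎ B)
  merge []       ys = map inj₂ ys
  merge (x ∷ xs) [] = inj₁ x ∷ map inj₁ xs
  merge (x ∷ xs) (y ∷ ys) =
    if size S x <ᵇ size T y then inj₁ x ∷ merge xs (y ∷ ys) else inj₂ y ∷ merge (x ∷ xs) ys

  merge-↭ : ∀ xs ys → merge xs ys ↭ map inj₁ xs ++ map inj₂ ys
  merge-↭ []       ys = ↭-refl
  merge-↭ (x ∷ xs) [] = ↭-reflexive (sym (++-identityʳ _))
  merge-↭ (x ∷ xs) (y ∷ ys) with size S x <ᵇ size T y | merge-↭ xs (y ∷ ys) | merge-↭ (x ∷ xs) ys
  ... | true  | ihˡ | _   = prep (inj₁ x) ihˡ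
  ... | false | _   | ihʳ = ↭-trans (prep (inj₂ y) ihʳ)
                        (↭-sym (↭-shift (inj₂ y) (map inj₁ (x ∷ xs)) (map inj₂ ys)))

  map-inj₁-partition : (xs : List A) → partitionSums {B = B} (map inj₁ xs) ≡ (xs , [])
  map-inj₁-partition []       = refl
  map-inj₁-partition (x ∷ xs) = cong (map₁ (x ∷_)) (map-inj₁-partition xs)

  map-inj₂-partition : (ys : List B) → partitionSums {A = A} (map inj₂ ys) ≡ ([] , ys)
  map-inj₂-partition []       = refl
  map-inj₂-partition (y ∷ ys) = cong (map₂ (y ∷_)) (map-inj₂-partition ys)

  partition-merge : ∀ xs ys → partitionSums (merge xs ys) ≡ (xs , ys)
  partition-merge []       ys = map-inj₂-partition ys
  partition-merge (x ∷ xs) [] = map-inj₁-partition (x ∷ xs)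
  partition-merge (x ∷ xs) (y ∷ ys)
    with size S x <ᵇ size T y | partition-merge xs (y ∷ ys) | partition-merge (x ∷ xs) ys
  ... | true  | ihˡ | _   = cong (map₁ (x ∷_)) ihˡ
  ... | false | _   | ihʳ = cong (map₂ (y ∷_)) ihʳ

  merge-injective : ∀ {xs xs′ ys ys′} → merge xs ys ≡ merge xs′ ys′ → (xs , ys) ≡ (xs′ , ys′)
  merge-injective {xs} {xs′} {ys} {ys′} eq =
    trans (sym (partition-merge xs ys)) (trans (cong partitionSums eq) (partition-merge xs′ ys′))

  map-inj₁-ascending : ∀ {xs} → Ascending S post v xs → Ascending (S ⊕ T) post v (map inj₁ xs)
  map-inj₁-ascending []       = []
  map-inj₁-ascending (p ∷ ps) = p ∷ map-inj₁-ascending ps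

  map-inj₂-ascending : ∀ {ys} → Ascending T post v ys → Ascending (S ⊕ T) post v (map inj₂ ys)
  map-inj₂-ascending []       = []
  map-inj₂-ascending (p ∷ ps) = p ∷ map-inj₂-ascending ps

  gap : ∀ {a b c} → post + c ≤ 1 → a < b → a + post + c ≤ b
  gap {a} {b} {c} h a<b = begin
    a + post + c   ≡⟨ +-assoc a post c ⟩
    a + (post + c) ≤⟨ +-monoʳ-≤ a h ⟩
    a + 1          ≡⟨ +-comm a 1 ⟩
    suc a          ≤⟨ a<b ⟩
    b              ∎
    where open ≤-Reasoning

  merge-ascending : ∀ xs ys {v} → Ascending S post v xs → Ascending T post v ys →
                    Ascending (S ⊕ T) post v (merge xs ys)
  merge-ascending []       ys []       qs = map-inj₂-ascending qs
  merge-ascending (x ∷ xs) [] (p ∷ ps) [] = p ∷ map-inj₁-ascending ps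
  merge-ascending (x ∷ xs) (y ∷ ys) (p ∷ ps) (q ∷ qs)
    with size S x <ᵇ size T y | <ᵇ-reflects-< (size S x) (size T y)
       -- `r` is the new bound for the head that is not emitted; the comparison supplies it in each
       -- branch.
       | (λ (r : _ ≤ _) → merge-ascending xs (y ∷ ys) ps (r ∷ qs))
       | (λ (r : _ ≤ _) → merge-ascending (x ∷ xs) ys (r ∷ ps) qs)
  ... | true  | ofʸ x<y | ihˡ | _   = p ∷ ihˡ (gap (tightʳ y) x<y)
  ... | false | ofⁿ x≮y | _   | ihʳ =
    q ∷ ihʳ (gap (tightˡ x) (≤∧≢⇒< (≮⇒≥ x≮y) (λ eq → apart x y (sym eq))))

  merge-consˡ : ∀ x xs ys → Ascending T post (size S x + post) ys →
                merge (x ∷ xs) ys ≡ inj₁ x ∷ merge xs ys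
  merge-consˡ x []       []       _ = refl
  merge-consˡ x (_ ∷ _)  []       _ = refl
  merge-consˡ x xs (y ∷ ys) (q ∷ _) with size S x <ᵇ size T y | <ᵇ-reflects-< (size S x) (size T y)
  ... | true  | ofʸ _   = refl
  ... | false | ofⁿ x≮y = contradiction (≤∧≢⇒< (m+n≤o⇒m≤o _ (m+n≤o⇒m≤o _ q)) (apart x y)) x≮y

  merge-consʳ : ∀ y xs ys → Ascending S post (size T y + post) xs →
                merge xs (y ∷ ys) ≡ inj₂ y ∷ merge xs ys
  merge-consʳ y []       ys _ = refl
  merge-consʳ y (x ∷ xs) ys (p ∷ _) with size S x <ᵇ size T y | <ᵇ-reflects-< (size S x) (size T y)
  ... | true  | ofʸ x<y = contradiction (m+n≤o⇒m≤o _ (m+n≤o⇒m≤o _ p)) (<⇒≱ x<y)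
  ... | false | ofⁿ _   = refl

  -- Dropping the elements of one kind keeps the others ascending, because the bound never falls
  -- along the list.
  merge-surjective : ∀ {zs} → Ascending (S ⊕ T) post v zs →
    ∃ λ xs → ∃ λ ys → Ascending S post v xs × Ascending T post v ys × merge xs ys ≡ zs
  merge-surjective [] = [] , [] , [] , [] , refl
  merge-surjective {zs = inj₁ x ∷ zs} (p ∷ ps)
    with xs , ys , as , bs , refl ← merge-surjective ps
    = x ∷ xs , ys , p ∷ as
    , weaken (m≤n⇒m≤n+o post (m+n≤o⇒m≤o _ p)) bs , merge-consˡ x xs ys bs
  merge-surjective {zs = inj₂ y ∷ zs} (p ∷ ps)
    with xs , ys , as , bs , refl ← merge-surjective ps
    = xs , y ∷ ys , weaken (m≤n⇒m≤n+o post (m+n≤o⇒m≤o _ p)) as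
    , p ∷ bs , merge-consʳ y xs ys as

-- Admits t v means that the elements allowed after the bound v are those of index at least t
-- (index t + 1 for an overlined part).
module Gaps (S : Scale A) (post : ℕ) (place : ℕ → C → A) (next : ℕ → C → ℕ)
            (Admits : ℕ → ℕ → Set)
            (fits : ∀ {v} t c → Admits t v → v + slack S (place t c) ≤ size S (place t c))
            (step : ∀ t c → Admits (next t c) (size S (place t c) + post))
            (find : ∀ {v} t x → Admits t v → v + slack S x ≤ size S x → ∃ λ c → place t c ≡ x)
            (place-injective : ∀ t {c c′} → place t c ≡ place t c′ → c ≡ c′) where

  decode : ℕ → List C → List A
  decode t []       = []
  decode t (c ∷ cs) = place t c ∷ decode (next t c) cs

  length-decode : ∀ t cs → length (decode t cs) ≡ length cs
  length-decode t []       = refl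
  length-decode t (c ∷ cs) = cong suc (length-decode (next t c) cs)

  decode-ascending : ∀ {t} cs → Admits t v → Ascending S post v (decode t cs)
  decode-ascending []       h = []
  decode-ascending {t = t} (c ∷ cs) h = fits t c h ∷ decode-ascending cs (step t c)

  decode-injective : ∀ {t} cs cs′ → decode t cs ≡ decode t cs′ → cs ≡ cs′
  decode-injective []       []         eq = refl
  decode-injective {t} (c ∷ cs) (c′ ∷ cs′) eq
    with e , es ← ∷-injective eq
    with refl ← place-injective t e
    = cong (c ∷_) (decode-injective cs cs′ es)

  decode-surjective : ∀ {t xs} → Admits t v → Ascending S post v xs → ∃ λ cs → decode t cs ≡ xs
  decode-surjective h [] = [] , refl
  decode-surjective {t = t} {xs = x ∷ xs} h (p ∷ ps)
    with c , refl ← find t x h p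
    with cs , refl ← decode-surjective (step t c) ps
    = c ∷ cs , refl

-- Sums over shuffles

total : (A → ℕ) → List A → ℕ
total h xs = sum (map h xs)

total-↭ : ∀ (h : A → ℕ) {xs ys} → xs ↭ ys → total h xs ≡ total h ys
total-↭ h p = sum-↭ (map⁺ h p)

total-⊎ : ∀ (h : A ⊎ B → ℕ) xs ys →
          total h (map inj₁ xs ++ map inj₂ ys) ≡ total (h ∘ inj₁) xs + total (h ∘ inj₂) ys
total-⊎ h xs ys = begin
  sum (map h (map inj₁ xs ++ map inj₂ ys))               ≡⟨ cong sum (map-++ h (map inj₁ xs) (map inj₂ ys)) ⟩
  sum (map h (map inj₁ xs) ++ map h (map inj₂ ys))       ≡⟨ sum-++ (map h (map inj₁ xs)) _ ⟩
  sum (map h (map inj₁ xs)) + sum (map h (map inj₂ ys))  ≡⟨ cong₂ (λ a b → sum a + sum b) (sym (map-∘ xs)) (sym (map-∘ ys)) ⟩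
  total (h ∘ inj₁) xs + total (h ∘ inj₂) ys              ∎
  where open ≡-Reasoning

total-const : ∀ c (xs : List A) → total (const c) xs ≡ length xs * c
total-const c []       = refl
total-const c (x ∷ xs) = cong (c +_) (total-const c xs)

cancel-≤ : ∀ k {r} m n → r < k → m * k ≤ r + n * k → m ≤ n
cancel-≤ k m n r<k h = s≤s⁻¹ (*-cancelʳ-< k m (suc n) (≤-<-trans h (+-monoˡ-< (n * k) r<k)))

-- Gap codes for odd parts and for residue classes

markedOdd : Scale (ℕ × Bool)
markedOdd .size (t , _) = 1 + t * 2
markedOdd .slack (_ , m) = bit m

placeD : ℕ → ℕ × Bool → ℕ × Bool
placeD t (g , m) = t + (bit m + g) , m

module D where

  next : ℕ → ℕ × Bool → ℕ
  next t c = proj₁ (placeD t c)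

  fits : ∀ {v} t c → v ≡ 1 + t * 2 → v + slack markedOdd (placeD t c) ≤ size markedOdd (placeD t c)
  fits t (g , m) refl = s≤s (begin
    t * 2 + bit m            ≤⟨ +-monoʳ-≤ (t * 2) (≤-trans (m≤m+n (bit m) g) (m≤m*n (bit m + g) 2)) ⟩
    t * 2 + (bit m + g) * 2  ≡⟨ *-distribʳ-+ 2 t (bit m + g) ⟨
    (t + (bit m + g)) * 2    ∎)
    where open ≤-Reasoning

  -- Odd numbers move in steps of 2, so a slack of 1 in size forces a full step of the index.
  index-≤ : ∀ t s m → t * 2 + bit m ≤ s * 2 → t + bit m ≤ s
  index-≤ t s false h = cancel-≤ 2 {0} (t + 0) s z<s (subst (_≤ s * 2) (arith t) h)
    where
    arith : ∀ t → t * 2 + 0 ≡ (t + 0) * 2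
    arith = solve-∀
  index-≤ t s true h = cancel-≤ 2 {1} (t + 1) s (s<s z<s) (subst (_≤ 1 + s * 2) (arith t) (s≤s h))
    where
    arith : ∀ t → suc (t * 2 + 1) ≡ (t + 1) * 2
    arith = solve-∀

  find : ∀ {v} t x → v ≡ 1 + t * 2 → v + slack markedOdd x ≤ size markedOdd x → ∃ λ c → placeD t c ≡ x
  find t (s , m) refl h =
    (s ∸ (t + bit m) , m) ,
    cong (_, m) (trans (sym (+-assoc t (bit m) _)) (m+[n∸m]≡n (index-≤ t s m (s≤s⁻¹ h))))

  place-injective : ∀ t {c c′} → placeD t c ≡ placeD t c′ → c ≡ c′
  place-injective t {g , m} {g′ , m′} eq with e , refl ← ,-injective eq =
    cong (_, m) (+-cancelˡ-≡ (bit m) _ _ (+-cancelˡ-≡ t _ _ e))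

  open Gaps markedOdd 0 placeD next (λ t v → v ≡ 1 + t * 2)
    fits (λ t c → +-identityʳ _) find place-injective public

arithmetic : (k r p : ℕ) → Scale ℕ
arithmetic k r p .size t = r + t * k
arithmetic k r p .slack _ = p

-- The index jump `j` between neighbours is 0 if repetition is allowed and 1 if not. The bounds on
-- `r` make 0 the first index after the starting bound 1.
module Residue (k r p post : ℕ) (0<k : 0 < k) (j≤1 : post + p ≤ 1)
               (p<r : p < r) (r≤k+p : r ≤ k + p) where

  private
    j = post + p

  -- The first inequality lets index `t` follow `v`; the second, written without subtraction,
  -- excludes the index before it.
  Admits : ℕ → ℕ → Set
  Admits t v = v + p ≤ r + t * k × t * k + r < k + (v + p)

  admits-start : Admits 0 1
  admits-start =
    subst (suc p ≤_) (sym (+-identityʳ r)) p<r , ≤-trans (s≤s r≤k+p) (≤-reflexive (sym (+-suc k p)))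

  j*k≤ : ∀ j → j ≤ 1 → j ≤ j * k × j * k < k + j
  j*k≤ zero    _       = z≤n , subst (0 <_) (sym (+-identityʳ k)) 0<k
  j*k≤ (suc .0) (s≤s z≤n) =
    subst (1 ≤_) (sym (+-identityʳ k)) 0<k , subst₂ _<_ (sym (+-identityʳ k)) (+-comm 1 k) ≤-refl

  step : ∀ n → Admits (j + n) (r + n * k + post)
  step n = lower , upper
    where
    open ≤-Reasoning
    arith : ∀ r x p q → r + x + p + q ≡ r + (p + q + x)
    arith = solve-∀
    arith′ : ∀ k r x j → k + j + (x + r) ≡ k + (r + (j + x))
    arith′ = solve-∀
    lower : r + n * k + post + p ≤ r + (j + n) * k
    lower = begin
      r + n * k + post + p  ≡⟨ arith r (n * k) post p ⟩
      r + (j + n * k)       ≤⟨ +-monoʳ-≤ r (+-monoˡ-≤ (n * k) (proj₁ (j*k≤ j j≤1))) ⟩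
      r + (j * k + n * k)   ≡⟨ cong (r +_) (*-distribʳ-+ k j n) ⟨
      r + (j + n) * k       ∎
    upper : (j + n) * k + r < k + (r + n * k + post + p)
    upper = begin-strict
      (j + n) * k + r            ≡⟨ cong (_+ r) (*-distribʳ-+ k j n) ⟩
      j * k + n * k + r          ≡⟨ +-assoc (j * k) (n * k) r ⟩
      j * k + (n * k + r)        <⟨ +-monoˡ-< (n * k + r) (proj₂ (j*k≤ j j≤1)) ⟩
      k + j + (n * k + r)        ≡⟨ arith′ k r (n * k) j ⟩
      k + (r + (j + n * k))      ≡⟨ cong (k +_) (arith r (n * k) post p) ⟨
      k + (r + n * k + post + p) ∎

  find-≤ : ∀ {v} t s → Admits t v → v + p ≤ r + s * k → t ≤ s
  find-≤ {v} t s (_ , h) h′ = s≤s⁻¹ (*-cancelʳ-< k t (suc s) (+-cancelʳ-< r (t * k) (suc s * k) (begin-strict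
    t * k + r        <⟨ h ⟩
    k + (v + p)      ≤⟨ +-monoʳ-≤ k h′ ⟩
    k + (r + s * k)  ≡⟨ arith k r (s * k) ⟩
    suc s * k + r    ∎)))
    where
    open ≤-Reasoning
    arith : ∀ k r x → k + (r + x) ≡ k + x + r
    arith = solve-∀

  open Gaps (arithmetic k r p) post _+_ (λ t g → j + (t + g)) Admits
    (λ t g h → ≤-trans (proj₁ h) (+-monoʳ-≤ r (*-monoˡ-≤ k (m≤m+n t g))))
    (λ t g → step (t + g))
    (λ t s h h′ → s ∸ t , m+[n∸m]≡n (find-≤ t s h h′))
    (λ t {g} {g′} → +-cancelˡ-≡ t g g′) public

  total-decode : ∀ t gs →
    total (size (arithmetic k r p)) (decode t gs) ≡ length gs * (t * k) + gapWeight k r j gs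
  total-decode t []       = refl
  total-decode t (g ∷ gs) rewrite total-decode (j + (t + g)) gs =
    arith k r j t g (length gs) (gapWeight k r j gs)
    where
    arith : ∀ k r j t g l w → r + (t + g) * k + (l * ((j + (t + g)) * k) + w)
          ≡ suc l * (t * k) + (suc l * (k * g) + r + j * k * l + w)
    arith = solve-∀

total-decodeD : ∀ t ds → total (size markedOdd) (D.decode t ds) ≡ length ds * (t * 2) + weightD ds
total-decodeD t []             = refl
total-decodeD t ((g , m) ∷ ds) rewrite total-decodeD (t + (bit m + g)) ds =
  arith t (bit m) g (length ds) (weightD ds)
  where
  arith : ∀ t b g l w → 1 + (t + (b + g)) * 2 + (l * ((t + (b + g)) * 2) + w)
        ≡ suc l * (t * 2) + (suc l * (2 * (b + g)) + 1 + w)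
  arith = solve-∀

bars-decodeD : ∀ t ds → total (bit ∘ proj₂) (D.decode t ds) ≡ bars ds
bars-decodeD t []             = refl
bars-decodeD t ((g , m) ∷ ds) = cong (bit m +_) (bars-decodeD _ ds)

-- Only `Y` allows repetition. The jump 1 comes from the slack in `Z`, and from `post` in `O` and
-- `E`, the distinct parts of ℬ.
module Y = Residue 4 2 0 0 z<s z≤n (s≤s z≤n) (s≤s (s≤s z≤n))
module Z = Residue 4 4 1 0 z<s ≤-refl (s≤s (s≤s z≤n)) (m≤m+n 4 1)
module O = Residue 2 1 0 1 z<s ≤-refl (s≤s z≤n) (m≤n+m 1 1)
module E = Residue 4 2 0 1 z<s ≤-refl (s≤s z≤n) (s≤s (s≤s z≤n))

-- Residues modulo 2 and 4

odd%2 : ∀ t → (1 + t * 2) % 2 ≡ 1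
odd%2 zero    = refl
odd%2 (suc t) = odd%2 t

odd%4 : ∀ t → (1 + t * 2) % 4 ≡ 1 ⊎ (1 + t * 2) % 4 ≡ 3
odd%4 zero          = inj₁ refl
odd%4 (suc zero)    = inj₂ refl
odd%4 (suc (suc t)) = odd%4 t

two%2 : ∀ t → (2 + t * 4) % 2 ≡ 0
two%2 zero    = refl
two%2 (suc t) = two%2 t

two%4 : ∀ t → (2 + t * 4) % 4 ≡ 2
two%4 zero    = refl
two%4 (suc t) = two%4 t

four%2 : ∀ t → (4 + t * 4) % 2 ≡ 0
four%2 zero    = refl
four%2 (suc t) = four%2 t

four%4 : ∀ t → (4 + t * 4) % 4 ≡ 0
four%4 zero    = refl
four%4 (suc t) = four%4 t

odd≢two : ∀ s t → 1 + s * 2 ≢ 2 + t * 4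
odd≢two s t eq with () ← trans (sym (odd%2 s)) (trans (cong (_% 2) eq) (two%2 t))

odd≢four : ∀ s t → 1 + s * 2 ≢ 4 + t * 4
odd≢four s t eq with () ← trans (sym (odd%2 s)) (trans (cong (_% 2) eq) (four%2 t))

two≢four : ∀ s t → 2 + s * 4 ≢ 4 + t * 4
two≢four s t eq with () ← trans (sym (two%4 s)) (trans (cong (_% 4) eq) (four%4 t))

data Class : ℕ → Set where
  odd  : ∀ t → Class (1 + t * 2)
  two  : ∀ t → Class (2 + t * 4)
  four : ∀ t → Class (4 + t * 4)

class : ∀ n → Class (suc n)
class 0 = odd 0
class 1 = two 0
class 2 = odd 1
class 3 = four 0
class (suc (suc (suc (suc n)))) with class n
... | odd t  = odd (2 + t)
... | two t  = two (suc t)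
... | four t = four (suc t)

-- Residual sequences and ℬ as shuffles

ElemA ElemB : Set
ElemA = (ℕ × Bool) ⊎ (ℕ ⊎ ℕ)
ElemB = ℕ ⊎ ℕ

pattern oddA t m = inj₁ (t , m)
pattern twoA t   = inj₂ (inj₁ t)
pattern fourA t  = inj₂ (inj₂ t)

twoMod4 fourMod4 odds : Scale ℕ
twoMod4  = arithmetic 4 2 0
fourMod4 = arithmetic 4 4 1
odds     = arithmetic 2 1 0

scaleA : Scale ElemA
scaleA = markedOdd ⊕ (twoMod4 ⊕ fourMod4)

scaleB : Scale ElemB
scaleB = odds ⊕ twoMod4

markedOdd≢even : ∀ x x′ → size markedOdd x ≢ size (twoMod4 ⊕ fourMod4) x′
markedOdd≢even (s , _) (inj₁ t) = odd≢two s t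
markedOdd≢even (s , _) (inj₂ t) = odd≢four s t

slack-markedOdd-≤1 : ∀ x → slack markedOdd x ≤ 1
slack-markedOdd-≤1 (_ , false) = z≤n
slack-markedOdd-≤1 (_ , true)  = ≤-refl

slack-even-≤1 : ∀ x → slack (twoMod4 ⊕ fourMod4) x ≤ 1
slack-even-≤1 (inj₁ _) = z≤n
slack-even-≤1 (inj₂ _) = ≤-refl

module YZ = Merge twoMod4 fourMod4 0 two≢four (λ _ → z≤n) (λ _ → ≤-refl)
module DYZ = Merge markedOdd (twoMod4 ⊕ fourMod4) 0 markedOdd≢even slack-markedOdd-≤1 slack-even-≤1
module OE = Merge odds twoMod4 1 odd≢two (λ _ → ≤-refl) (λ _ → ≤-refl)

arrangeA : List (ℕ × Bool) → List ℕ → List ℕ → List ElemA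
arrangeA ds ys zs = reverse (DYZ.merge (D.decode 0 ds) (YZ.merge (Y.decode 0 ys) (Z.decode 0 zs)))

arrangeB : List ℕ → List ℕ → List ElemB
arrangeB ss ks = reverse (OE.merge (O.decode 0 ss) (E.decode 0 ks))

total-arrangeA : ∀ h ds ys zs → total h (arrangeA ds ys zs)
  ≡ total (h ∘ inj₁) (D.decode 0 ds)
    + (total (h ∘ inj₂ ∘ inj₁) (Y.decode 0 ys) + total (h ∘ inj₂ ∘ inj₂) (Z.decode 0 zs))
total-arrangeA h ds ys zs = begin
  total h (reverse (DYZ.merge D′ (YZ.merge Y′ Z′)))                 ≡⟨ total-↭ h (↭-reverse (DYZ.merge D′ (YZ.merge Y′ Z′))) ⟩
  total h (DYZ.merge D′ (YZ.merge Y′ Z′))                           ≡⟨ total-↭ h (DYZ.merge-↭ D′ _) ⟩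
  total h (map inj₁ D′ ++ map inj₂ (YZ.merge Y′ Z′))                ≡⟨ total-⊎ h D′ _ ⟩
  total (h ∘ inj₁) D′ + total (h ∘ inj₂) (YZ.merge Y′ Z′)           ≡⟨ cong (_ +_) (total-↭ (h ∘ inj₂) (YZ.merge-↭ Y′ Z′)) ⟩
  total (h ∘ inj₁) D′ + total (h ∘ inj₂) (map inj₁ Y′ ++ map inj₂ Z′) ≡⟨ cong (_ +_) (total-⊎ (h ∘ inj₂) Y′ Z′) ⟩
  total (h ∘ inj₁) D′ + (total (h ∘ inj₂ ∘ inj₁) Y′ + total (h ∘ inj₂ ∘ inj₂) Z′) ∎
  where
  open ≡-Reasoning
  D′ = D.decode 0 ds
  Y′ = Y.decode 0 ys
  Z′ = Z.decode 0 zs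

total-arrangeB : ∀ h ss ks → total h (arrangeB ss ks)
  ≡ total (h ∘ inj₁) (O.decode 0 ss) + total (h ∘ inj₂) (E.decode 0 ks)
total-arrangeB h ss ks =
  trans (total-↭ h (↭-reverse (OE.merge O′ E′)))
        (trans (total-↭ h (OE.merge-↭ O′ E′)) (total-⊎ h O′ E′))
  where
  O′ = O.decode 0 ss
  E′ = E.decode 0 ks

arrangeA-descending : ∀ ds ys zs → Descending scaleA 0 (arrangeA ds ys zs)
arrangeA-descending ds ys zs = ʳ++-descending
  (DYZ.merge-ascending _ _ (D.decode-ascending ds refl)
    (YZ.merge-ascending _ _ (Y.decode-ascending ys Y.admits-start)
                            (Z.decode-ascending zs Z.admits-start)))
  []

arrangeB-descending : ∀ ss ks → Descending scaleB 1 (arrangeB ss ks)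
arrangeB-descending ss ks = ʳ++-descending
  (OE.merge-ascending _ _ (O.decode-ascending ss O.admits-start)
                          (E.decode-ascending ks E.admits-start))
  []

arrangeA-surjective : ∀ {L} → Descending scaleA 0 L →
                      ∃ λ ds → ∃ λ ys → ∃ λ zs → arrangeA ds ys zs ≡ L
arrangeA-surjective {L} desc =
  let _ , _ , ascᵈ , ascʸᶻ , eq = DYZ.merge-surjective (ʳ++-ascending desc [])
      _ , _ , ascʸ , ascᶻ , eqʸᶻ = YZ.merge-surjective ascʸᶻ
      ds , eqᵈ = D.decode-surjective {t = 0} refl ascᵈ
      ys , eqʸ = Y.decode-surjective {t = 0} Y.admits-start ascʸ
      zs , eqᶻ = Z.decode-surjective {t = 0} Z.admits-start ascᶻ
  in ds , ys , zs ,
     trans (cong reverse (trans (cong₂ DYZ.merge eqᵈ (trans (cong₂ YZ.merge eqʸ eqᶻ) eqʸᶻ)) eq))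
           (reverse-involutive L)

arrangeB-surjective : ∀ {L} → Descending scaleB 1 L → ∃ λ ss → ∃ λ ks → arrangeB ss ks ≡ L
arrangeB-surjective {L} desc =
  let _ , _ , ascᵒ , ascᵉ , eq = OE.merge-surjective (ʳ++-ascending desc [])
      ss , eqᵒ = O.decode-surjective {t = 0} O.admits-start ascᵒ
      ks , eqᵉ = E.decode-surjective {t = 0} E.admits-start ascᵉ
  in ss , ks , trans (cong reverse (trans (cong₂ OE.merge eqᵒ eqᵉ) eq)) (reverse-involutive L)

arrangeA-injective : ∀ {ds ds′ ys ys′ zs zs′} → arrangeA ds ys zs ≡ arrangeA ds′ ys′ zs′ →
                     ds ≡ ds′ × ys ≡ ys′ × zs ≡ zs′
arrangeA-injective {ds} {ds′} {ys} {ys′} {zs} {zs′} eq =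
  let eqᵈ , eqʸᶻ = ,-injective (DYZ.merge-injective (reverse-injective eq))
      eqʸ , eqᶻ = ,-injective (YZ.merge-injective eqʸᶻ)
  in D.decode-injective ds ds′ eqᵈ , Y.decode-injective ys ys′ eqʸ , Z.decode-injective zs zs′ eqᶻ

arrangeB-injective : ∀ {ss ss′ ks ks′} → arrangeB ss ks ≡ arrangeB ss′ ks′ → ss ≡ ss′ × ks ≡ ks′
arrangeB-injective {ss} {ss′} {ks} {ks′} eq =
  let eqᵒ , eqᵉ = ,-injective (OE.merge-injective (reverse-injective eq))
  in O.decode-injective ss ss′ eqᵒ , E.decode-injective ks ks′ eqᵉ

-- The staircase and the set 𝒜

sizeA slackA : ElemA → ℕ
sizeA  = size scaleA
slackA = slack scaleA

shift : ℕ → ElemA → ElemA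
shift n (oddA t m) = oddA (n * 2 + t) m
shift n (twoA t)   = twoA (n + t)
shift n (fourA t)  = fourA (n + t)

size-shift : ∀ n x → sizeA (shift n x) ≡ n * 4 + sizeA x
size-shift n (oddA t m) = arith n t
  where
  arith : ∀ n t → 1 + (n * 2 + t) * 2 ≡ n * 4 + (1 + t * 2)
  arith = solve-∀
size-shift n (twoA t) = arith n t
  where
  arith : ∀ n t → 2 + (n + t) * 4 ≡ n * 4 + (2 + t * 4)
  arith = solve-∀
size-shift n (fourA t) = arith n t
  where
  arith : ∀ n t → 4 + (n + t) * 4 ≡ n * 4 + (4 + t * 4)
  arith = solve-∀

slack-shift : ∀ n x → slackA (shift n x) ≡ slackA x
slack-shift n (oddA t m) = refl
slack-shift n (twoA t)   = refl
slack-shift n (fourA t)  = refl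

shift-injective : ∀ n {x x′} → shift n x ≡ shift n x′ → x ≡ x′
shift-injective n {oddA s m} {oddA t m′} eq with e , refl ← ,-injective (inj₁-injective eq) =
  cong (λ t → oddA t m) (+-cancelˡ-≡ (n * 2) s t e)
shift-injective n {oddA _ _} {twoA _} ()
shift-injective n {oddA _ _} {fourA _} ()
shift-injective n {twoA s} {twoA t} eq =
  cong (inj₂ ∘ inj₁) (+-cancelˡ-≡ n s t (inj₁-injective (inj₂-injective eq)))
shift-injective n {fourA s} {fourA t} eq =
  cong (inj₂ ∘ inj₂) (+-cancelˡ-≡ n s t (inj₂-injective (inj₂-injective eq)))

unshift : ∀ n x → n * 4 + 1 ≤ sizeA x → ∃ λ x′ → shift n x′ ≡ x
unshift n (oddA t m) h = oddA (t ∸ n * 2) m , cong (λ t → oddA t m) (m+[n∸m]≡n n*2≤t)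
  where
  n*2≤t = cancel-≤ 2 {0} (n * 2) t z<s
    (subst (_≤ t * 2) (sym (*-assoc n 2 2)) (s≤s⁻¹ (subst (_≤ 1 + t * 2) (+-comm (n * 4) 1) h)))
unshift n (twoA t) h = twoA (t ∸ n) , cong (inj₂ ∘ inj₁) (m+[n∸m]≡n n≤t)
  where n≤t = cancel-≤ 4 {1} n t (s≤s (s≤s z≤n)) (s≤s⁻¹ (subst (_≤ 2 + t * 4) (+-comm (n * 4) 1) h))
unshift n (fourA t) h = fourA (t ∸ n) , cong (inj₂ ∘ inj₂) (m+[n∸m]≡n n≤t)
  where n≤t = cancel-≤ 4 {3} n t ≤-refl (s≤s⁻¹ (subst (_≤ 4 + t * 4) (+-comm (n * 4) 1) h))

exception : List ElemA
exception = oddA 2 true ∷ oddA 0 false ∷ []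

-- Restores the staircase: each part gains 4 for every smaller part, the exceptional pair included.
lift : Bool → List ElemA → List ElemA
lift f []       = if f then exception else []
lift f (x ∷ xs) = shift (length (lift f xs)) x ∷ lift f xs

floor : List ElemA → ℕ
floor []      = 1
floor (x ∷ _) = sizeA x + 4

-- Only neighbours are compared. The pair 5̄, 1 is a base case because nothing fits below a 1.
data Legal : List ElemA → Set where
  []          : Legal []
  exceptional : Legal exception
  _∷_         : ∀ {x xs} → floor xs + slackA x ≤ sizeA x → Legal xs → Legal (x ∷ xs)

length-lift : ∀ f xs → length (lift f xs) ≡ length xs + offset f
length-lift true  []       = refl
length-lift false []       = refl
length-lift f     (x ∷ xs) = cong suc (length-lift f xs)

-- The staircase absorbs the difference 4. The pair fits in because it leaves the floor 5 + 4 = 2 *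
-- 4 + 1, the same as an empty residual list raised by two steps.
floor-lift : ∀ f xs → floor (lift f xs) ≡ length (lift f xs) * 4 + top scaleA 0 xs
floor-lift true  []       = refl
floor-lift false []       = refl
floor-lift f     (x ∷ xs) =
  trans (cong (_+ 4) (size-shift (length (lift f xs)) x)) (arith (length (lift f xs) * 4) (sizeA x))
  where
  arith : ∀ n s → n + s + 4 ≡ 4 + n + (s + 0)
  arith = solve-∀

lift-gap : ∀ f xs x → let x′ = shift (length (lift f xs)) x in
           floor (lift f xs) + slackA x′ ≡ length (lift f xs) * 4 + (top scaleA 0 xs + slackA x)
lift-gap f xs x = trans (cong₂ _+_ (floor-lift f xs) (slack-shift (length (lift f xs)) x))
                        (+-assoc (length (lift f xs) * 4) _ _)

lift-fits : ∀ f x xs → top scaleA 0 xs + slackA x ≤ sizeA x →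
            let x′ = shift (length (lift f xs)) x in floor (lift f xs) + slackA x′ ≤ sizeA x′
lift-fits f x xs p =
  subst₂ _≤_ (sym (lift-gap f xs x)) (sym (size-shift (length (lift f xs)) x))
         (+-monoʳ-≤ (length (lift f xs) * 4) p)

lift-legal : ∀ f {xs} → Descending scaleA 0 xs → Legal (lift f xs)
lift-legal true  [] = exceptional
lift-legal false [] = []
lift-legal f {x ∷ xs} (p ∷ ps) = lift-fits f x xs p ∷ lift-legal f ps

-- A lifted overlined head keeps a difference of 5 to the next part, whereas 5̄ and 1 differ by only
-- 4.
lift-not-exception : ∀ f {x xs} → Descending scaleA 0 (x ∷ xs) → lift f (x ∷ xs) ≢ exception
lift-not-exception f {x} {xs} (p ∷ _) eq with eqˣ , eqˣˢ ← ∷-injective eq =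
  contradiction (subst₂ (λ l x′ → floor l + slackA x′ ≤ sizeA x′) eqˣˢ eqˣ (lift-fits f x xs p)) (<-irrefl refl)

lift-injective : ∀ f f′ {xs xs′} → Descending scaleA 0 xs → Descending scaleA 0 xs′ →
                 lift f xs ≡ lift f′ xs′ → f ≡ f′ × xs ≡ xs′
lift-injective true  true  [] [] eq = refl , refl
lift-injective false false [] [] eq = refl , refl
lift-injective true  f′    [] qs@(_ ∷ _) eq = contradiction (sym eq) (lift-not-exception f′ qs)
lift-injective f     true  ps@(_ ∷ _) [] eq = contradiction eq (lift-not-exception f ps)
lift-injective f f′ {x ∷ xs} {x′ ∷ xs′} (_ ∷ ps) (_ ∷ qs) eq
  with eqˣ , eqˣˢ ← ∷-injective eq
  with refl , refl ← lift-injective f f′ ps qs eqˣˢ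
  = refl , cong (_∷ xs) (shift-injective (length (lift f xs)) eqˣ)

top-positive : ∀ xs → 1 ≤ top scaleA 0 xs
top-positive []             = ≤-refl
top-positive (oddA _ _ ∷ _) = s≤s z≤n
top-positive (twoA _ ∷ _)   = s≤s z≤n
top-positive (fourA _ ∷ _)  = s≤s z≤n

lift-surjective : ∀ {xs} → Legal xs → ∃ λ f → ∃ λ xs′ → Descending scaleA 0 xs′ × lift f xs′ ≡ xs
lift-surjective [] = false , [] , [] , refl
lift-surjective exceptional = true , [] , [] , refl
lift-surjective {x ∷ _} (p ∷ ps)
  with f , xs , desc , refl ← lift-surjective ps
  -- The floor exceeds four times the number of smaller parts, so that multiple can be subtracted
  -- from `x`.
  with x′ , refl ← unshift (length (lift f xs)) x
         (≤-trans (+-monoʳ-≤ (length (lift f xs) * 4) (top-positive xs))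
                  (≤-trans (≤-reflexive (sym (floor-lift f xs))) (m+n≤o⇒m≤o _ p)))
  = f , x′ ∷ xs
  , +-cancelˡ-≤ (length (lift f xs) * 4) _ _
      (subst₂ _≤_ (lift-gap f xs x′) (size-shift (length (lift f xs)) x′) p) ∷ desc
  , refl

total-lift-invariant : ∀ (h : ElemA → ℕ) → (∀ n x → h (shift n x) ≡ h x) → ∀ f xs →
                       total h (lift f xs) ≡ total h xs + total h (lift f [])
total-lift-invariant h inv f []       = refl
total-lift-invariant h inv f (x ∷ xs) =
  trans (cong₂ _+_ (inv _ x) (total-lift-invariant h inv f xs)) (sym (+-assoc (h x) _ _))

total-size-lift : ∀ f xs → total sizeA (lift f xs) ≡ total sizeA xs + staircase f (length xs)
total-size-lift true  [] = refl
total-size-lift false [] = refl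
total-size-lift f (x ∷ xs)
  rewrite size-shift (length (lift f xs)) x | length-lift f xs | total-size-lift f xs
  = arith (length xs + offset f) (sizeA x) (total sizeA xs) (staircase f (length xs))
  where
  arith : ∀ n s t u → n * 4 + s + (t + u) ≡ s + t + (4 * n + u)
  arith = solve-∀

-- Elements as parts: membership in 𝒜

mark secondary : ElemA → Bool
mark      = [ proj₂ , [ const false , const false ] ]
secondary = [ proj₂ , [ const false , const true ] ]

mStat ℓStat : ElemA → ℕ
mStat = [ const 1 , [ const 0 , const 2 ] ]
ℓStat = [ bit ∘ proj₂ , [ const 1 , const 0 ] ]

toPart : ElemA → Part
toPart x = sizeA x , mark x

slack-secondary : ∀ x → slackA x ≡ bit (secondary x)
slack-secondary (oddA t m) = refl
slack-secondary (twoA t)   = refl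
slack-secondary (fourA t)  = refl

-- Identifies the test for strictness in `gapOK` with slack 1.
secondary-toPart : ∀ x → over (toPart x) ∨ (val (toPart x) % 4 ≡ᵇ 0) ≡ secondary x
secondary-toPart (oddA t true) = refl
secondary-toPart (oddA t false) with (1 + t * 2) % 4 | odd%4 t
... | .1 | inj₁ refl = refl
... | .3 | inj₂ refl = refl
secondary-toPart (twoA t)  rewrite two%4 t  = refl
secondary-toPart (fourA t) rewrite four%4 t = refl

toPart-injective : ∀ {x x′} → toPart x ≡ toPart x′ → x ≡ x′
toPart-injective {oddA s m} {oddA t m′} eq with eqˢ , refl ← ,-injective eq =
  cong (λ t → oddA t m) (*-cancelʳ-≡ s t 2 (suc-injective eqˢ))
toPart-injective {oddA s m} {twoA t}  eq = contradiction (cong proj₁ eq) (odd≢two s t)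
toPart-injective {oddA s m} {fourA t} eq = contradiction (cong proj₁ eq) (odd≢four s t)
toPart-injective {twoA s} {oddA t m}  eq = contradiction (cong proj₁ (sym eq)) (odd≢two t s)
toPart-injective {twoA s} {twoA t}    eq =
  cong (inj₂ ∘ inj₁) (*-cancelʳ-≡ s t 4 (+-cancelˡ-≡ 2 _ _ (cong proj₁ eq)))
toPart-injective {twoA s} {fourA t}   eq = contradiction (cong proj₁ eq) (two≢four s t)
toPart-injective {fourA s} {oddA t m} eq = contradiction (cong proj₁ (sym eq)) (odd≢four t s)
toPart-injective {fourA s} {twoA t}   eq = contradiction (cong proj₁ (sym eq)) (two≢four t s)
toPart-injective {fourA s} {fourA t}  eq =
  cong (inj₂ ∘ inj₂) (*-cancelʳ-≡ s t 4 (+-cancelˡ-≡ 4 _ _ (cong proj₁ eq)))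

T-< : ∀ {a b} → T (a <ᵇ b) → a < b
T-< = <ᵇ⇒< _ _

gapOK-sound : ∀ x x′ → T (gapOK (toPart x) (toPart x′)) →
              (x ≡ oddA 2 true × x′ ≡ oddA 0 false) ⊎ (sizeA x′ + 4 + slackA x ≤ sizeA x)
gapOK-sound x x′ h with to T-∨ h
... | inj₁ h₅ =
  let e₅ , h₁ = to T-∧ h₅
      eᵐ , h₂ = to T-∧ h₁
      e₁ , eⁿ = to T-∧ h₂
  in inj₁ ( toPart-injective (cong₂ _,_ (≡ᵇ⇒≡ (sizeA x) 5 e₅) (to T-≡ eᵐ))
          , toPart-injective (cong₂ _,_ (≡ᵇ⇒≡ (sizeA x′) 1 e₁) (to T-not-≡ eⁿ)))
... | inj₂ h₄ rewrite secondary-toPart x | slack-secondary x with secondary x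
... | false = inj₂ (subst (_≤ sizeA x) (sym (+-identityʳ (sizeA x′ + 4)))
                     (s≤s⁻¹ (T-< (proj₁ (to T-∧ h₄)))))
... | true  = inj₂ (subst (_≤ sizeA x) (sym (+-assoc (sizeA x′) 4 1))
                     (s≤s⁻¹ (T-< {b = suc (sizeA x)} (proj₂ (to T-∧ h₄)))))

gapOK-complete : ∀ x x′ → sizeA x′ + 4 + slackA x ≤ sizeA x → T (gapOK (toPart x) (toPart x′))
gapOK-complete x x′ h = from (T-∨ {exceptionalGap}) (inj₂ (from T-∧ (<⇒<ᵇ (s≤s (m+n≤o⇒m≤o (sizeA x′ + 4) h)) , strict h)))
  where
  exceptionalGap : Bool
  exceptionalGap = (sizeA x ≡ᵇ 5) ∧ mark x ∧ (sizeA x′ ≡ᵇ 1) ∧ not (mark x′)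
  strict : sizeA x′ + 4 + slackA x ≤ sizeA x →
           T (not (mark x ∨ (sizeA x % 4 ≡ᵇ 0)) ∨ (sizeA x′ + 5 ≤ᵇ sizeA x))
  strict h rewrite secondary-toPart x | slack-secondary x with secondary x
  ... | false = tt
  ... | true  = <⇒<ᵇ (s≤s (subst (_≤ sizeA x) (+-assoc (sizeA x′) 4 1) h))

floor-positive : ∀ xs → 1 ≤ floor xs
floor-positive []             = ≤-refl
floor-positive (oddA _ _ ∷ _) = s≤s z≤n
floor-positive (twoA _ ∷ _)   = s≤s z≤n
floor-positive (fourA _ ∷ _)  = s≤s z≤n

positive : ∀ x → T (1 ≤ᵇ val (toPart x))
positive (oddA t m) = tt
positive (twoA t)   = tt
positive (fourA t)  = tt

-- For an overlined part the hypothesis reads 2 ≤ size, which excludes an overlined 1.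
overlineOK-complete : ∀ x → 1 + slackA x ≤ sizeA x → T (overlineOK (toPart x))
overlineOK-complete (oddA t false) h = tt
overlineOK-complete (oddA t true)  h rewrite odd%2 t = <⇒<ᵇ (s≤s h)
overlineOK-complete (twoA t)       h = tt
overlineOK-complete (fourA t)      h = tt

overlineOK-sound : ∀ p → T (1 ≤ᵇ val p) → T (overlineOK p) →
                   ∃ λ x → toPart x ≡ p × 1 + slackA x ≤ sizeA x
overlineOK-sound (suc n , m) _ h with class n
overlineOK-sound (suc _ , true)  _ h | odd t = oddA t true , refl , s≤s⁻¹ (T-< (proj₂ (to T-∧ h)))
overlineOK-sound (suc _ , false) _ h | odd t = oddA t false , refl , s≤s z≤n
overlineOK-sound (suc _ , true)  _ h | two t rewrite two%2 t with () ← h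
overlineOK-sound (suc _ , false) _ h | two t = twoA t , refl , s≤s z≤n
overlineOK-sound (suc _ , true)  _ h | four t rewrite four%2 t with () ← h
overlineOK-sound (suc _ , false) _ h | four t = fourA t , refl , s≤s (s≤s z≤n)

isValid : List Part → Bool
isValid xs = isOverpartition xs ∧ inA xs

legal-sound : ∀ xs → T (all (λ x → 1 ≤ᵇ val x) xs) → T (all overlineOK xs) → T (allPairs gapOK xs) →
              ∃ λ L → Legal L × map toPart L ≡ xs
legal-sound [] _ _ _ = [] , [] , refl
legal-sound (p ∷ ps) h₁ h₂ h₃
  with L , legal , refl ← legal-sound ps (proj₂ (to T-∧ h₁)) (proj₂ (to T-∧ h₂)) (proj₂ (to (T-∧ {all (gapOK p) ps}) h₃))
  with x , refl , fits ← overlineOK-sound p (proj₁ (to T-∧ h₁)) (proj₁ (to T-∧ h₂))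
  with L | legal
... | [] | _ = x ∷ [] , fits ∷ [] , refl
... | x′ ∷ L′ | legal
  with gapOK-sound x x′ (proj₁ (to (T-∧ {gapOK (toPart x) (toPart x′)}) (proj₁ (to T-∧ h₃))))
... | inj₂ gap = x ∷ x′ ∷ L′ , gap ∷ legal , refl
... | inj₁ (refl , refl) with legal
...   | _∷_ {xs = []} _ _ = exception , exceptional , refl
-- A part below the 1 would put the floor at 4 or more.
...   | _∷_ {xs = x″ ∷ _} le _ =
  contradiction (≤-trans (m≤n+m 4 (sizeA x″)) (m+n≤o⇒m≤o _ le)) (<⇒≱ (s≤s (s≤s z≤n)))

-- Passes from neighbours to all pairs. Strictness depends on the larger part alone, so clearing the
-- floor with slack suffices against every smaller part.
below-floor : ∀ {L} → Legal L → All (λ x → sizeA x + 4 ≤ floor L) L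
below-floor []          = []
below-floor exceptional = ≤-refl ∷ m≤m+n 5 4 ∷ []
below-floor (p ∷ ps)    =
  ≤-refl ∷ All.map (λ le → ≤-trans le (≤-trans (m+n≤o⇒m≤o _ p) (m≤m+n _ 4))) (below-floor ps)

legal-complete : ∀ {L} → Legal L → T (isValid (map toPart L))
legal-complete {L} legal =
  from T-∧ ( from T-∧ (positives L , decreasing legal) , from T-∧ (overlines legal , gaps legal))
  where
  positives : ∀ L → T (all (λ x → 1 ≤ᵇ val x) (map toPart L))
  positives []      = tt
  positives (x ∷ L) = from T-∧ (positive x , positives L)
  overlines : ∀ {L} → Legal L → T (all overlineOK (map toPart L))
  overlines []          = tt
  overlines exceptional = tt
  overlines (_∷_ {x} {xs} p ps) =
    from T-∧ (overlineOK-complete x (≤-trans (+-monoˡ-≤ _ (floor-positive xs)) p) , overlines ps)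
  gaps : ∀ {L} → Legal L → T (allPairs gapOK (map toPart L))
  gaps []          = tt
  gaps exceptional = tt
  gaps (_∷_ {x} {xs} p ps) = from T-∧ (row (below-floor ps) , gaps ps)
    where
    row : ∀ {L} → All (λ x → sizeA x + 4 ≤ floor xs) L → T (all (gapOK (toPart x)) (map toPart L))
    row []                = tt
    row {x′ ∷ _} (q ∷ qs) = from T-∧ (gapOK-complete x x′ (≤-trans (+-monoˡ-≤ _ q) p) , row qs)
  decreasing : ∀ {L} → Legal L →
    T (allConsecutive (λ x y → (val y <ᵇ val x) ∨ ((val y ≡ᵇ val x) ∧ not (over y))) (map toPart L))
  decreasing []             = tt
  decreasing exceptional    = tt
  decreasing (_ ∷ [])       = tt
  -- The floor above the pair is 9, more than 5.
  decreasing (p ∷ exceptional) = from T-∧ (from T-∨ (inj₁ (<⇒<ᵇ (≤-trans (s≤s (m≤m+n 5 3)) (m+n≤o⇒m≤o _ p)))) , tt)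
  decreasing (_∷_ {x} {x′ ∷ _} p ps@(_ ∷ _)) =
    from T-∧ (from T-∨ (inj₁ (<⇒<ᵇ (<-≤-trans (m<m+n (sizeA x′) z<s) (m+n≤o⇒m≤o _ p)))) , decreasing ps)

m-parts : ∀ L → ♯ 1 2 (map toPart L) + 2 * ♯ 0 4 (map toPart L) ≡ total mStat L
m-parts [] = refl
m-parts (x ∷ L) = trans (cases x (♯ 1 2 (map toPart L)) (♯ 0 4 (map toPart L))) (cong (mStat x +_) (m-parts L))
  where
  arith : ∀ a b → a + 2 * suc b ≡ 2 + (a + 2 * b)
  arith = solve-∀
  cases : ∀ x a b → (if sizeA x % 2 ≡ᵇ 1 then 1 else 0) + a + 2 * ((if sizeA x % 4 ≡ᵇ 0 then 1 else 0) + b)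
                    ≡ mStat x + (a + 2 * b)
  cases (oddA t m) a b rewrite odd%2 t with (1 + t * 2) % 4 | odd%4 t
  ... | .1 | inj₁ refl = refl
  ... | .3 | inj₂ refl = refl
  cases (twoA t)  a b rewrite two%2 t | two%4 t   = refl
  cases (fourA t) a b rewrite four%2 t | four%4 t = arith a b

ℓ-parts : ∀ L → ♯ 2 4 (map toPart L) + 𝖮 (map toPart L) ≡ total ℓStat L
ℓ-parts [] = refl
ℓ-parts (x ∷ L) = trans (cases x (♯ 2 4 (map toPart L)) (𝖮 (map toPart L))) (cong (ℓStat x +_) (ℓ-parts L))
  where
  overlined : ∀ m a b → a + ((if m then 1 else 0) + b) ≡ bit m + (a + b)
  overlined true  a b = +-suc a b
  overlined false a b = refl
  cases : ∀ x a b → (if sizeA x % 4 ≡ᵇ 2 then 1 else 0) + a + ((if mark x then 1 else 0) + b)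
                    ≡ ℓStat x + (a + b)
  cases (oddA t m) a b with (1 + t * 2) % 4 | odd%4 t
  ... | .1 | inj₁ refl = overlined m a b
  ... | .3 | inj₂ refl = overlined m a b
  cases (twoA t)  a b rewrite two%4 t  = refl
  cases (fourA t) a b rewrite four%4 t = refl

-- The coding of 𝒜 and its statistics

encodeA : ACode → List Part
encodeA (f , ds , ys , zs) = map toPart (lift f (arrangeA ds ys zs))

encodeA-valid : ∀ c → T (isValid (encodeA c))
encodeA-valid (f , ds , ys , zs) = legal-complete (lift-legal f (arrangeA-descending ds ys zs))

encodeA-surjective : ∀ xs → T (isValid xs) → ∃ λ c → encodeA c ≡ xs
encodeA-surjective xs h =
  let h₁ , h₂ = to (T-∧ {isOverpartition xs}) h
      h₃ , h₄ = to (T-∧ {all overlineOK xs}) h₂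
      L , legal , eq = legal-sound xs (proj₁ (to (T-∧ {all (λ x → 1 ≤ᵇ val x) xs}) h₁)) h₃ h₄
      f , L′ , desc , eq′ = lift-surjective legal
      ds , ys , zs , eq″ = arrangeA-surjective desc
  in (f , ds , ys , zs) , trans (cong (map toPart) (trans (cong (lift f) eq″) eq′)) eq

encodeA-injective : ∀ {c c′} → encodeA c ≡ encodeA c′ → c ≡ c′
encodeA-injective {f , ds , ys , zs} {f′ , ds′ , ys′ , zs′} eq =
  let eqᶠ , eqᴸ = lift-injective f f′ (arrangeA-descending ds ys zs) (arrangeA-descending ds′ ys′ zs′)
                                 (map-injective toPart-injective eq)
      eqᵈ , eqʸ , eqᶻ = arrangeA-injective eqᴸ
  in cong₂ _,_ eqᶠ (cong₂ _,_ eqᵈ (cong₂ _,_ eqʸ eqᶻ))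

total-one : (xs : List A) → total (const 1) xs ≡ length xs
total-one xs = trans (total-const 1 xs) (*-identityʳ (length xs))

total-zero : (xs : List A) → total (const 0) xs ≡ 0
total-zero xs = trans (total-const 0 xs) (*-zeroʳ (length xs))

length-arrangeA : ∀ ds ys zs → length (arrangeA ds ys zs) ≡ length ds + (length ys + length zs)
length-arrangeA ds ys zs = begin
  length (arrangeA ds ys zs)          ≡⟨ total-one (arrangeA ds ys zs) ⟨
  total (const 1) (arrangeA ds ys zs) ≡⟨ total-arrangeA (const 1) ds ys zs ⟩
  total (const 1) (D.decode 0 ds) + (total (const 1) (Y.decode 0 ys) + total (const 1) (Z.decode 0 zs))
    ≡⟨ cong₂ _+_ (trans (total-one (D.decode 0 ds)) (D.length-decode 0 ds))
         (cong₂ _+_ (trans (total-one (Y.decode 0 ys)) (Y.length-decode 0 ys))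
                    (trans (total-one (Z.decode 0 zs)) (Z.length-decode 0 zs))) ⟩
  length ds + (length ys + length zs) ∎
  where open ≡-Reasoning

weight-encodeA : ∀ c → weight (encodeA c) ≡ weightA c
weight-encodeA (f , ds , ys , zs) = begin
  sum (map val (map toPart (lift f L)))  ≡⟨ cong sum (map-∘ (lift f L)) ⟨
  total sizeA (lift f L)                 ≡⟨ total-size-lift f L ⟩
  total sizeA L + staircase f (length L)
    ≡⟨ cong₂ _+_
         (trans (total-arrangeA sizeA ds ys zs)
                (cong₂ _+_ (from-zero (length ds) (total-decodeD 0 ds))
                  (cong₂ _+_ (from-zero (length ys) (Y.total-decode 0 ys))
                             (from-zero (length zs) (Z.total-decode 0 zs)))))
         (cong (staircase f) (length-arrangeA ds ys zs)) ⟩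
  weightA (f , ds , ys , zs) ∎
  where
  open ≡-Reasoning
  L = arrangeA ds ys zs

  -- Decoding starts at index 0, so the contribution of the starting index vanishes.
  from-zero : ∀ n {a b} → a ≡ n * 0 + b → a ≡ b
  from-zero n {b = b} eq = trans eq (cong (_+ b) (*-zeroʳ n))

m-encodeA : ∀ c → ♯ 1 2 (encodeA c) + 2 * ♯ 0 4 (encodeA c) ≡ mA c
m-encodeA (f , ds , ys , zs) = begin
  ♯ 1 2 (map toPart (lift f L)) + 2 * ♯ 0 4 (map toPart (lift f L)) ≡⟨ m-parts (lift f L) ⟩
  total mStat (lift f L)                   ≡⟨ total-lift-invariant mStat invariant f L ⟩
  total mStat L + total mStat (lift f [])  ≡⟨ cong₂ _+_ (total-arrangeA mStat ds ys zs) (exceptional-m f) ⟩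
  total (const 1) D′ + (total (const 0) Y′ + total (const 2) Z′) + offset f
    ≡⟨ cong (_+ offset f) (cong₂ _+_ (trans (total-one D′) (D.length-decode 0 ds))
         (cong₂ _+_ (total-zero Y′) (trans (total-const 2 Z′) (cong (_* 2) (Z.length-decode 0 zs))))) ⟩
  length ds + (0 + length zs * 2) + offset f ≡⟨ arith (length ds) (length zs) (offset f) ⟩
  mA (f , ds , ys , zs) ∎
  where
  open ≡-Reasoning
  L  = arrangeA ds ys zs
  D′ = D.decode 0 ds
  Y′ = Y.decode 0 ys
  Z′ = Z.decode 0 zs

  exceptional-m : ∀ f → total mStat (lift f []) ≡ offset f
  exceptional-m true  = refl
  exceptional-m false = refl
  invariant : ∀ n x → mStat (shift n x) ≡ mStat x
  invariant n (oddA t m) = refl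
  invariant n (twoA t)   = refl
  invariant n (fourA t)  = refl
  arith : ∀ a c o → a + (0 + c * 2) + o ≡ o + a + 2 * c
  arith = solve-∀

ℓ-encodeA : ∀ c → ♯ 2 4 (encodeA c) + 𝖮 (encodeA c) ≡ ℓA c
ℓ-encodeA (f , ds , ys , zs) = begin
  ♯ 2 4 (map toPart (lift f L)) + 𝖮 (map toPart (lift f L)) ≡⟨ ℓ-parts (lift f L) ⟩
  total ℓStat (lift f L)                   ≡⟨ total-lift-invariant ℓStat invariant f L ⟩
  total ℓStat L + total ℓStat (lift f [])  ≡⟨ cong₂ _+_ (total-arrangeA ℓStat ds ys zs) (exceptional-ℓ f) ⟩
  total (bit ∘ proj₂) D′ + (total (const 1) Y′ + total (const 0) Z′) + bit f
    ≡⟨ cong (_+ bit f) (cong₂ _+_ (bars-decodeD 0 ds)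
         (cong₂ _+_ (trans (total-one Y′) (Y.length-decode 0 ys)) (total-zero Z′))) ⟩
  bars ds + (length ys + 0) + bit f        ≡⟨ arith (bars ds) (length ys) (bit f) ⟩
  ℓA (f , ds , ys , zs) ∎
  where
  open ≡-Reasoning
  L  = arrangeA ds ys zs
  D′ = D.decode 0 ds
  Y′ = Y.decode 0 ys
  Z′ = Z.decode 0 zs

  exceptional-ℓ : ∀ f → total ℓStat (lift f []) ≡ bit f
  exceptional-ℓ true  = refl
  exceptional-ℓ false = refl
  invariant : ∀ n x → ℓStat (shift n x) ≡ ℓStat x
  invariant n (oddA t m) = refl
  invariant n (twoA t)   = refl
  invariant n (fourA t)  = refl
  arith : ∀ a c o → a + (c + 0) + o ≡ o + a + c
  arith = solve-∀

-- The coding of ℬ and its statistics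

sizeB : ElemB → ℕ
sizeB = size scaleB

sizeB-injective : ∀ {x x′} → sizeB x ≡ sizeB x′ → x ≡ x′
sizeB-injective {inj₁ s} {inj₁ t} eq = cong inj₁ (*-cancelʳ-≡ s t 2 (suc-injective eq))
sizeB-injective {inj₁ s} {inj₂ t} eq = contradiction eq (odd≢two s t)
sizeB-injective {inj₂ s} {inj₁ t} eq = contradiction (sym eq) (odd≢two t s)
sizeB-injective {inj₂ s} {inj₂ t} eq = cong inj₂ (*-cancelʳ-≡ s t 4 (+-cancelˡ-≡ 2 _ _ eq))

slackB-zero : ∀ x → slack scaleB x ≡ 0
slackB-zero (inj₁ _) = refl
slackB-zero (inj₂ _) = refl

sizeB-positive : ∀ x → 1 ≤ sizeB x
sizeB-positive (inj₁ _) = s≤s z≤n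
sizeB-positive (inj₂ _) = s≤s z≤n

not%4 : ℕ → Bool
not%4 a = not (a % 4 ≡ᵇ 0)

not%4-sound : ∀ n → T (1 ≤ᵇ n) → T (not%4 n) → ∃ λ x → sizeB x ≡ n
not%4-sound (suc n) _ h with class n
... | odd t  = inj₁ t , refl
... | two t  = inj₂ t , refl
... | four t rewrite four%4 t with () ← h

not%4-complete : ∀ x → T (not%4 (sizeB x))
not%4-complete (inj₁ t) with (1 + t * 2) % 4 | odd%4 t
... | .1 | inj₁ refl = tt
... | .3 | inj₂ refl = tt
not%4-complete (inj₂ t) rewrite two%4 t = tt

isValidB : List ℕ → Bool
isValidB xs = isDistinctPartition xs ∧ all not%4 xs

descending-sound : ∀ xs → T (all (λ a → 1 ≤ᵇ a) xs) → T (allConsecutive (λ a b → b <ᵇ a) xs) →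
                   T (all not%4 xs) → ∃ λ L → Descending scaleB 1 L × map sizeB L ≡ xs
descending-sound [] _ _ _ = [] , [] , refl
descending-sound (n ∷ []) h₁ _ h₃
  with x , refl ← not%4-sound n (proj₁ (to T-∧ h₁)) (proj₁ (to T-∧ h₃))
  = x ∷ [] , subst (λ s → 1 + s ≤ sizeB x) (sym (slackB-zero x)) (sizeB-positive x) ∷ [] , refl
descending-sound (n ∷ n′ ∷ ns) h₁ h₂ h₃
  with descending-sound (n′ ∷ ns) (proj₂ (to (T-∧ {1 ≤ᵇ n}) h₁))
                        (proj₂ (to (T-∧ {n′ <ᵇ n}) h₂)) (proj₂ (to (T-∧ {not%4 n}) h₃))
     | not%4-sound n (proj₁ (to T-∧ h₁)) (proj₁ (to T-∧ h₃))
... | x′ ∷ L , desc , refl | x , refl =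
  x ∷ x′ ∷ L
  -- With slack 0 and `post` 1 the required bound is plain strict decrease.
  , subst₂ (λ a s → a + s ≤ sizeB x) (+-comm 1 (sizeB x′)) (sym (slackB-zero x))
      (subst (_≤ sizeB x) (sym (+-identityʳ _)) (T-< (proj₁ (to (T-∧ {sizeB x′ <ᵇ sizeB x}) h₂)))) ∷ desc
  , refl

descending-complete : ∀ {L} → Descending scaleB 1 L → T (isValidB (map sizeB L))
descending-complete {L} desc = from T-∧ (from T-∧ (positives L , decreasing desc) , residues L)
  where
  positives : ∀ L → T (all (λ a → 1 ≤ᵇ a) (map sizeB L))
  positives []      = tt
  positives (x ∷ L) = from T-∧ (<⇒<ᵇ (s≤s (sizeB-positive x)) , positives L)
  residues : ∀ L → T (all not%4 (map sizeB L))
  residues []      = tt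
  residues (x ∷ L) = from T-∧ (not%4-complete x , residues L)
  decreasing : ∀ {L} → Descending scaleB 1 L → T (allConsecutive (λ a b → b <ᵇ a) (map sizeB L))
  decreasing []       = tt
  decreasing (_ ∷ []) = tt
  decreasing (_∷_ {x} {x′ ∷ _} p ps@(_ ∷ _)) =
    from T-∧ (<⇒<ᵇ (subst (_≤ sizeB x) (+-comm (sizeB x′) 1) (m+n≤o⇒m≤o _ p)) , decreasing ps)

oddStat evenStat : ElemB → ℕ
oddStat  = [ const 1 , const 0 ]
evenStat = [ const 0 , const 1 ]

odd-parts : ∀ L → count (λ a → a % 2 ≡ᵇ 1) (map sizeB L) ≡ total oddStat L
odd-parts [] = refl
odd-parts (inj₁ t ∷ L) rewrite odd%2 t = cong suc (odd-parts L)
odd-parts (inj₂ t ∷ L) rewrite two%2 t = odd-parts L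

even-parts : ∀ L → count (λ a → a % 2 ≡ᵇ 0) (map sizeB L) ≡ total evenStat L
even-parts [] = refl
even-parts (inj₁ t ∷ L) rewrite odd%2 t = even-parts L
even-parts (inj₂ t ∷ L) rewrite two%2 t = cong suc (even-parts L)

encodeB : List ℕ → List ℕ → List ℕ
encodeB ss ks = map sizeB (arrangeB ss ks)

encodeB-surjective : ∀ xs → T (isValidB xs) → ∃ λ ss → ∃ λ ks → encodeB ss ks ≡ xs
encodeB-surjective xs h =
  let h₁ , h₂ = to (T-∧ {isDistinctPartition xs}) h
      h₃ , h₄ = to (T-∧ {all (λ a → 1 ≤ᵇ a) xs}) h₁
      L , desc , eq = descending-sound xs h₃ h₄ h₂
      ss , ks , eq′ = arrangeB-surjective desc
  in ss , ks , trans (cong (map sizeB) eq′) eq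

weight-encodeB : ∀ ss ks → sum (encodeB ss ks) ≡ weightO ss + weightE ks
weight-encodeB ss ks = trans (total-arrangeB sizeB ss ks)
  (cong₂ _+_ (trans (O.total-decode 0 ss) (cong (_+ weightO ss) (*-zeroʳ (length ss))))
             (trans (E.total-decode 0 ks) (cong (_+ weightE ks) (*-zeroʳ (length ks)))))

odd-encodeB : ∀ ss ks → count (λ a → a % 2 ≡ᵇ 1) (encodeB ss ks) ≡ length ss
odd-encodeB ss ks = begin
  count (λ a → a % 2 ≡ᵇ 1) (encodeB ss ks)  ≡⟨ odd-parts (arrangeB ss ks) ⟩
  total oddStat (arrangeB ss ks)            ≡⟨ total-arrangeB oddStat ss ks ⟩
  total (const 1) (O.decode 0 ss) + total (const 0) (E.decode 0 ks)
    ≡⟨ cong₂ _+_ (trans (total-one (O.decode 0 ss)) (O.length-decode 0 ss)) (total-zero (E.decode 0 ks)) ⟩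
  length ss + 0                             ≡⟨ +-identityʳ (length ss) ⟩
  length ss                                 ∎
  where open ≡-Reasoning

even-encodeB : ∀ ss ks → count (λ a → a % 2 ≡ᵇ 0) (encodeB ss ks) ≡ length ks
even-encodeB ss ks = begin
  count (λ a → a % 2 ≡ᵇ 0) (encodeB ss ks)  ≡⟨ even-parts (arrangeB ss ks) ⟩
  total evenStat (arrangeB ss ks)           ≡⟨ total-arrangeB evenStat ss ks ⟩
  total (const 0) (O.decode 0 ss) + total (const 1) (E.decode 0 ks)
    ≡⟨ cong₂ _+_ (total-zero (O.decode 0 ss)) (trans (total-one (E.decode 0 ks)) (E.length-decode 0 ks)) ⟩
  length ks                                 ∎
  where open ≡-Reasoning

-- Both sets through one common code

Statistics : ℕ → ℕ → ℕ → List ℕ × List ℕ → Set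
Statistics n m ℓ (ss , ks) = weightO ss + weightE ks ≡ n × length ss ≡ m × length ks ≡ ℓ

-- Validity and the three equations are propositions, so elements are equal as soon as their first
-- components are; a bijective code that respects the statistics then restricts to each fibre.
coded-↔ : {n m ℓ : ℕ} {valid : X → Bool} {weightX mX ℓX : X → ℕ}
          (code : List ℕ × List ℕ → X) →
          (∀ c → T (valid (code c))) →
          (∀ x → T (valid x) → ∃ λ c → code c ≡ x) →
          (∀ {c c′} → code c ≡ code c′ → c ≡ c′) →
          (∀ ss ks → weightX (code (ss , ks)) ≡ weightO ss + weightE ks) →
          (∀ ss ks → mX (code (ss , ks)) ≡ length ss) →
          (∀ ss ks → ℓX (code (ss , ks)) ≡ length ks) →
          Σ (List ℕ × List ℕ) (Statistics n m ℓ) ↔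
          Σ X (λ x → T (valid x) × weightX x ≡ n × mX x ≡ m × ℓX x ≡ ℓ)
coded-↔ {X} {n} {m} {ℓ} {valid} {weightX} {mX} {ℓX} code code-valid surj inj eqⁿ eqᵐ eqˡ =
  mk↔ₛ′ forth back forth-back back-forth
  where
  Codes Coded : Set
  Codes = Σ (List ℕ × List ℕ) (Statistics n m ℓ)
  Coded = Σ X (λ x → T (valid x) × weightX x ≡ n × mX x ≡ m × ℓX x ≡ ℓ)

  forth : Codes → Coded
  forth ((ss , ks) , p , q , r) =
    code (ss , ks) , code-valid (ss , ks)
    , trans (eqⁿ ss ks) p , trans (eqᵐ ss ks) q , trans (eqˡ ss ks) r

  back : Coded → Codes
  back (x , h , p , q , r) with (ss , ks) , refl ← surj x h =
    (ss , ks) , trans (sym (eqⁿ ss ks)) p , trans (sym (eqᵐ ss ks)) q , trans (sym (eqˡ ss ks)) r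

  coded-≡ : {u v : Coded} → proj₁ u ≡ proj₁ v → u ≡ v
  coded-≡ {_ , h , p , q , r} {_ , h′ , p′ , q′ , r′} refl
    rewrite T-irrelevant h h′ | ≡-irrelevant p p′ | ≡-irrelevant q q′ | ≡-irrelevant r r′ = refl

  codes-≡ : {u v : Codes} → proj₁ u ≡ proj₁ v → u ≡ v
  codes-≡ {_ , p , q , r} {_ , p′ , q′ , r′} refl
    rewrite ≡-irrelevant p p′ | ≡-irrelevant q q′ | ≡-irrelevant r r′ = refl

  code-back : ∀ u → code (proj₁ (back u)) ≡ proj₁ u
  code-back (x , h , p , q , r) with (ss , ks) , refl ← surj x h = refl

  forth-back : ∀ u → forth (back u) ≡ u
  forth-back u = coded-≡ (code-back u)

  back-forth : ∀ c → back (forth c) ≡ c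
  -- Surjectivity returns some preimage of the coded object; injectivity makes it the original one.
  back-forth c = codes-≡ (inj (code-back (forth c)))

codes-↔-SetA : ∀ n m ℓ → Σ (List ℕ × List ℕ) (Statistics n m ℓ) ↔ SetA n m ℓ
codes-↔-SetA n m ℓ = coded-↔ {valid = isValid} {weight} {λ xs → ♯ 1 2 xs + 2 * ♯ 0 4 xs} {λ xs → ♯ 2 4 xs + 𝖮 xs}
  (λ (ss , ks) → encodeA (build ss ks))
  (λ (ss , ks) → encodeA-valid (build ss ks))
  (λ xs h → let c , eq = encodeA-surjective xs h
                ss , ks , eq′ = build-surjective c
            in (ss , ks) , trans (cong encodeA eq′) eq)
  (λ {(ss , _)} {(ss′ , _)} eq →
     let eqˢ , eqᵏ = build-injective ss ss′ (encodeA-injective eq) in cong₂ _,_ eqˢ eqᵏ)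
  (λ ss ks → trans (weight-encodeA (build ss ks)) (weight-build ss ks))
  (λ ss ks → trans (m-encodeA (build ss ks)) (m-build ss ks))
  (λ ss ks → trans (ℓ-encodeA (build ss ks)) (ℓ-build ss ks))

codes-↔-SetB : ∀ n m ℓ → Σ (List ℕ × List ℕ) (Statistics n m ℓ) ↔ SetB n m ℓ
codes-↔-SetB n m ℓ = coded-↔ {valid = isValidB} {sum} {count (λ a → a % 2 ≡ᵇ 1)} {count (λ a → a % 2 ≡ᵇ 0)}
  (λ (ss , ks) → encodeB ss ks)
  (λ (ss , ks) → descending-complete (arrangeB-descending ss ks))
  (λ xs h → let ss , ks , eq = encodeB-surjective xs h in (ss , ks) , eq)
  (λ eq → let eqˢ , eqᵏ = arrangeB-injective (map-injective sizeB-injective eq) in cong₂ _,_ eqˢ eqᵏ)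
  weight-encodeB odd-encodeB even-encodeB

theorem1p3 : (n m ℓ : ℕ) → SetA n m ℓ ↔ SetB n m ℓ
theorem1p3 n m ℓ = ↔-trans (↔-sym (codes-↔-SetA n m ℓ)) (codes-↔-SetB n m ℓ)
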